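{- Let $G$ be a connected vertex-transitive graph with $|V(G)|\geq 3$. Then every path of length at most $4$ in $G$ closes to a cycle. Moreover, for every integer $\ell\geq 5$ there exist infinitely many connected vertex-transitive graphs each containing a path of length $\ell$ that does not close to any cycle.
   Context: All graphs are finite, simple and undirected, and graphs are considered up to isomorphism. A path of length $\ell$ (an $\ell$-edge path) in $G$ is a sequence $(x_0,\dots,x_\ell)$ of pairwise distinct vertices with $x_i x_{i+1}\in E(G)$ for $0\le i\le \ell-1$; a path of length $0$ is a single vertex. A cycle is a sequence $(x_0,\dots,x_{\ell-1},x_\ell=x_0)$ with $\ell\ge 3$, $x_0,\dots,x_{\ell-1}$ pairwise distinct and $x_ix_{i+1}\in E(G)$ for all $0\le i\le \ell-1$. Paths and cycles are identified with the subgraphs formed by their vertices and edges. A path $P$ closes to a cycle if there is a cycle $C$ in $G$ such that $P$ is a subgraph of $C$. A graph is vertex-transitive if its automorphism group acts transitively on its vertices. -}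

module Defs where

open import Data.Nat using (ℕ; zero; suc; _+_; _≤_)
open import Data.Nat.DivMod using (_mod_)
open import Data.Fin using (Fin; toℕ; inject₁; fromℕ)
open import Data.Bool using (Bool; true; false)
open import Data.Product using (Σ; ∃; _×_; _,_)
open import Data.Sum using (_⊎_)
open import Relation.Binary.PropositionalEquality using (_≡_)
open import Function.Definitions using (Injective; Bijective)

record Graph (n : ℕ) : Set where
  field
    adj   : Fin n → Fin n → Bool
    sym   : ∀ x y → adj x y ≡ adj y x
    irref : ∀ x → adj x x ≡ false

open Graph public

Adj : ∀ {n} → Graph n → Fin n → Fin n → Set
Adj G x y = adj G x y ≡ true

record Path {n : ℕ} (G : Graph n) (ℓ : ℕ) : Set where
  field
    vert     : Fin (suc ℓ) → Fin n
    distinct : Injective _≡_ _≡_ vert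
    edges    : ∀ (j : Fin ℓ) → Adj G (vert (inject₁ j)) (vert (Fin.suc j))

open Path public

next : ∀ {m} → Fin (suc m) → Fin (suc m)
next {m} i = suc (toℕ i) mod (suc m)

-- A cycle of length k + 3 (so length ≥ 3): pairwise distinct x₀ … x_{k+2},
-- consecutive (cyclically) adjacent.
record Cycle {n : ℕ} (G : Graph n) : Set where
  field
    len      : ℕ
    cvert    : Fin (suc (suc (suc len))) → Fin n
    cdistinct : Injective _≡_ _≡_ cvert
    cedges   : ∀ i → Adj G (cvert i) (cvert (next i))

open Cycle public

CycleEdge : ∀ {n} {G : Graph n} → Cycle G → Fin n → Fin n → Set
CycleEdge C a b = ∃ λ i → (cvert C i ≡ a × cvert C (next i) ≡ b)
                         ⊎ (cvert C i ≡ b × cvert C (next i) ≡ a)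

SubgraphOf : ∀ {n} {G : Graph n} {ℓ} → Path G ℓ → Cycle G → Set
SubgraphOf P C =
  (∀ j → ∃ λ i → cvert C i ≡ vert P j)
  × (∀ (j : Fin _) → CycleEdge C (vert P (inject₁ j)) (vert P (Fin.suc j)))

ClosesToCycle : ∀ {n} {G : Graph n} {ℓ} → Path G ℓ → Set
ClosesToCycle {G = G} P = Σ (Cycle G) λ C → SubgraphOf P C

Connected : ∀ {n} → Graph n → Set
Connected {n} G = ∀ u v → Σ ℕ λ ℓ → Σ (Path G ℓ) λ P →
  vert P Fin.zero ≡ u × vert P (fromℕ ℓ) ≡ v

IsAutomorphism : ∀ {n} → Graph n → (Fin n → Fin n) → Set
IsAutomorphism G σ = Bijective _≡_ _≡_ σ × (∀ x y → adj G (σ x) (σ y) ≡ adj G x y)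

VertexTransitive : ∀ {n} → Graph n → Set
VertexTransitive {n} G = ∀ u v → Σ (Fin n → Fin n) λ σ → IsAutomorphism G σ × σ u ≡ v

{-# OPTIONS --safe #-}
module Submission where

-- Positive part: if a path x₀ … x_ℓ with 2 ≤ ℓ ≤ 4 does not close, its at most three inner vertices
-- separate x₀ from x_ℓ.  For the separation with the smallest boundary κ ≤ 3 and, among these, the
-- smallest side, submodularity of the boundary makes the translates of that side ("atoms") pairwise
-- disjoint, and makes the boundary of an atom a union of atoms; were the boundary a single atom, the
-- two would make up the whole graph.  So the size a of an atom satisfies 2a ≤ κ ≤ 3, hence a = 1 and
-- the degree is at most the size of every separating boundary.  The inner vertices are then attached
-- to both sides as well as to each other, which exceeds that degree.
-- Negative part: in the square of a long cycle the path 2, 0, 1, 3, 4, 5, … does not close, since all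
-- four neighbours of 2 are inner vertices.

open import Defs
open import Data.Nat using (ℕ; _≤_)
open import Data.Product using (Σ; _×_)
open import Relation.Nullary using (¬_)
open import Data.Bool using (Bool; true; false; _∧_; _∨_)
import Data.Bool.Properties as Bool
open import Data.Empty using (⊥; ⊥-elim)
open import Data.Fin using (Fin; toℕ; inject₁; fromℕ; fromℕ<)
open import Data.Fin.Patterns using (0F; 1F; 2F; 3F)
open import Data.Fin.Permutation using (permutation)
import Data.Fin.Properties as Finₚ
open Finₚ using (_≟_; any?; toℕ-fromℕ<; toℕ<n; toℕ-injective; toℕ-inject₁; toℕ-fromℕ)
open import Data.Fin.Relation.Unary.Top using (view; ‵fromℕ; ‵inject₁)
open import Data.List using (List; []; _∷_; length; lookup; tabulate)
open import Data.List.Membership.DecPropositional using () renaming (_∈?_ to ∈ˡ-dec)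
open import Data.List.Membership.Propositional using () renaming (_∈_ to _∈ˡ_; _∉_ to _∉ˡ_)
open import Data.List.Membership.Propositional.Properties using (∈-lookup; ∈-tabulate⁺)
open import Data.List.Relation.Unary.All using (All; []; _∷_)
open import Data.List.Relation.Unary.AllPairs using ([]; _∷_)
open import Data.List.Relation.Unary.Any using (here; there; index)
open import Data.List.Relation.Unary.Any.Properties using (lookup-index)
open import Data.List.Relation.Unary.Unique.Propositional using (Unique)
open import Data.Nat using (zero; suc; _+_; _∸_; _%_; _<_; z≤n; s≤s; s≤s⁻¹)
open import Data.Nat.DivMod using (m<n⇒m%n≡m; n%n≡0)
open import Data.Nat.Induction using (<-wellFounded)
open import Data.Nat.Properties hiding (_≟_)
open import Data.Product using (∃; _,_; proj₁; proj₂)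
open import Data.Sum using (_⊎_; inj₁; inj₂; [_,_]′)
open import Function using (_∘_)
open import Function.Definitions using (Injective; Bijective)
open import Induction.WellFounded using (Acc; acc)
import Relation.Binary.PropositionalEquality as ≡
open ≡ hiding (sym)
open import Relation.Nullary using (does; yes; no; Dec; ¬?; contradiction)
open import Relation.Nullary.Decidable using (True; toWitness; dec-true; dec-false; _×-dec_)
open import Algebra.Properties.CommutativeMonoid.Sum +-0-commutativeMonoid using (sum; sum-cong-≋; ∑-distrib-+; ∑-permute)

-- Finite sets of vertices

VSet : ℕ → Set
VSet n = Fin n → Bool

infix 4 _∈_ _∉_ _⊆_

_∈_ _∉_ : ∀ {n} → Fin n → VSet n → Set
x ∈ S = S x ≡ true
x ∉ S = ¬ x ∈ S

_∈?_ : ∀ {n} (x : Fin n) (S : VSet n) → Dec (x ∈ S)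
x ∈? S = S x Bool.≟ true

_⊆_ : ∀ {n} → VSet n → VSet n → Set
S ⊆ T = ∀ {x} → x ∈ S → x ∈ T

_∩_ _∪_ : ∀ {n} → VSet n → VSet n → VSet n
(S ∩ T) x = S x ∧ T x
(S ∪ T) x = S x ∨ T x

abstract
  -- Kept opaque so that membership is handled through the two lemmas below and does not unfold to a
  -- decision procedure.
  comprehend : ∀ {n} {P : Fin n → Set} → (∀ x → Dec (P x)) → VSet n
  comprehend P? x = does (P? x)

  ∈-comprehend⁻ : ∀ {n} {P : Fin n → Set} (P? : ∀ x → Dec (P x)) {x} → x ∈ comprehend P? → P x
  ∈-comprehend⁻ P? {x} e with P? x
  ... | yes p = p
  ∈-comprehend⁻ P? () | no _

  ∈-comprehend⁺ : ∀ {n} {P : Fin n → Set} (P? : ∀ x → Dec (P x)) {x} → P x → x ∈ comprehend P?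
  ∈-comprehend⁺ P? {x} = dec-true (P? x)

∈-∩⁺ : ∀ {n} (S T : VSet n) {x} → x ∈ S → x ∈ T → x ∈ S ∩ T
∈-∩⁺ S T p q = cong₂ _∧_ p q

∈-∩⁻ : ∀ {n} (S T : VSet n) {x} → x ∈ S ∩ T → x ∈ S × x ∈ T
∈-∩⁻ S T {x} e with S x | T x
... | true | true = refl , refl
∈-∩⁻ S T () | true  | false
∈-∩⁻ S T () | false | _

∈-∪⁺ˡ : ∀ {n} (S T : VSet n) {x} → x ∈ S → x ∈ S ∪ T
∈-∪⁺ˡ S T {x} p = cong (_∨ T x) p

∈-∪⁺ʳ : ∀ {n} (S T : VSet n) {x} → x ∈ T → x ∈ S ∪ T
∈-∪⁺ʳ S T {x} p = trans (cong (S x ∨_) p) (Bool.∨-zeroʳ (S x))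

∈-∪⁻ : ∀ {n} (S T : VSet n) {x} → x ∈ S ∪ T → x ∈ S ⊎ x ∈ T
∈-∪⁻ S T {x} e with S x
... | true  = inj₁ refl
... | false = inj₂ e

indicator : Bool → ℕ
indicator false = 0
indicator true  = 1

card : ∀ {n} → VSet n → ℕ
card S = sum (indicator ∘ S)

sum-mono : ∀ {n} {f g : Fin n → ℕ} → (∀ i → f i ≤ g i) → sum f ≤ sum g
sum-mono {zero}  _ = z≤n
sum-mono {suc n} p = +-mono-≤ (p Fin.zero) (sum-mono (p ∘ Fin.suc))

sum-mono-< : ∀ {n} {f g : Fin n → ℕ} → (∀ i → f i ≤ g i) → ∀ j → f j < g j → sum f < sum g
sum-mono-< p Fin.zero    q = +-mono-<-≤ q (sum-mono (p ∘ Fin.suc))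
sum-mono-< p (Fin.suc j) q = +-mono-≤-< (p Fin.zero) (sum-mono-< (p ∘ Fin.suc) j q)

sum-0 : ∀ n → sum {n} (λ _ → 0) ≡ 0
sum-0 zero    = refl
sum-0 (suc n) = sum-0 n

sum-1 : ∀ n → sum {n} (λ _ → 1) ≡ n
sum-1 zero    = refl
sum-1 (suc n) = cong suc (sum-1 n)

indicator-mono : ∀ p q → (p ≡ true → q ≡ true) → indicator p ≤ indicator q
indicator-mono false q     _ = z≤n
indicator-mono true  true  _ = ≤-refl
indicator-mono true  false h with () ← h refl

indicator-mono₂ : ∀ p q r s → (p ≡ true → r ≡ true ⊎ s ≡ true) → (q ≡ true → r ≡ true ⊎ s ≡ true) →
  (p ≡ true → q ≡ true → r ≡ true × s ≡ true) → indicator p + indicator q ≤ indicator r + indicator s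
indicator-mono₂ p q true true _ _ _ = +-mono-≤ (indicator≤1 p) (indicator≤1 q)
  where
  indicator≤1 : ∀ b → indicator b ≤ 1
  indicator≤1 false = z≤n
  indicator≤1 true  = ≤-refl
indicator-mono₂ false false r s _ _ _ = z≤n
indicator-mono₂ true  true  r s _ _ h with refl , refl ← h refl refl = ≤-refl
indicator-mono₂ true  false false true _ _ _ = ≤-refl
indicator-mono₂ true  false true  false _ _ _ = ≤-refl
indicator-mono₂ true  false false false h _ _ with h refl
... | inj₁ ()
... | inj₂ ()
indicator-mono₂ false true  false true _ _ _ = ≤-refl
indicator-mono₂ false true  true  false _ _ _ = ≤-refl
indicator-mono₂ false true  false false _ h _ with h refl
... | inj₁ ()
... | inj₂ ()

card-mono : ∀ {n} {S T : VSet n} → S ⊆ T → card S ≤ card T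
card-mono {S = S} {T} p = sum-mono λ x → indicator-mono (S x) (T x) p

card-mono-< : ∀ {n} {S T : VSet n} → S ⊆ T → ∀ {x} → x ∉ S → x ∈ T → card S < card T
card-mono-< {S = S} {T} p {x} x∉S x∈T =
  sum-mono-< (λ y → indicator-mono (S y) (T y) p) x (strict (S x) (T x) x∉S x∈T)
  where
  strict : ∀ p q → ¬ p ≡ true → q ≡ true → indicator p < indicator q
  strict false true _ _ = ≤-refl
  strict true  _    h _ = contradiction refl h

-- Multiset inclusion, checked vertex by vertex: what the left side counts once the right side must
-- count, and what it counts twice must be counted twice. Most counting below is an instance, with
-- `empty` as filler where one side has a single set.
card-mono₂ : ∀ {n} (P Q R S : VSet n) → (∀ {x} → x ∈ P → x ∈ R ⊎ x ∈ S) → (∀ {x} → x ∈ Q → x ∈ R ⊎ x ∈ S) →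
  (∀ {x} → x ∈ P → x ∈ Q → x ∈ R × x ∈ S) → card P + card Q ≤ card R + card S
card-mono₂ P Q R S h₁ h₂ h₃ = subst₂ _≤_ (∑-distrib-+ (indicator ∘ P) (indicator ∘ Q)) (∑-distrib-+ (indicator ∘ R) (indicator ∘ S))
  (sum-mono λ x → indicator-mono₂ (P x) (Q x) (R x) (S x) h₁ h₂ h₃)

card≤n : ∀ {n} (S : VSet n) → card S ≤ n
card≤n {n} S = subst (card S ≤_) (sum-1 n) (card-mono {S = S} {λ _ → true} λ _ → refl)

empty : ∀ {n} → VSet n
empty _ = false

singleton : ∀ {n} → Fin n → VSet n
singleton x y = does (y ≟ x)

card-singleton : ∀ {n} (x : Fin n) → card (singleton x) ≡ 1
card-singleton {suc n} Fin.zero    = cong suc (sum-0 n)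
card-singleton {suc n} (Fin.suc x) = card-singleton x

x∈singleton : ∀ {n} (x : Fin n) → x ∈ singleton x
x∈singleton x = dec-true (x ≟ x) refl

∈-singleton⁻ : ∀ {n} {x y : Fin n} → y ∈ singleton x → y ≡ x
∈-singleton⁻ {x = x} {y} e with y ≟ x
... | yes p = p
∈-singleton⁻ () | no _

_∖_ : ∀ {n} → VSet n → Fin n → VSet n
S ∖ x = comprehend (λ y → (y ∈? S) ×-dec ¬? (y ≟ x))

∈-∖⁺ : ∀ {n} (S : VSet n) {x y} → y ∈ S → y ≢ x → y ∈ S ∖ x
∈-∖⁺ S {x} p q = ∈-comprehend⁺ (λ y → (y ∈? S) ×-dec ¬? (y ≟ x)) (p , q)

∈-∖⁻ : ∀ {n} (S : VSet n) {x y} → y ∈ S ∖ x → y ∈ S × y ≢ x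
∈-∖⁻ S {x} = ∈-comprehend⁻ (λ y → (y ∈? S) ×-dec ¬? (y ≟ x))

card≤length : ∀ {n} (S : VSet n) (xs : List (Fin n)) → (∀ {x} → x ∈ S → x ∈ˡ xs) → card S ≤ length xs
card≤length {n} S [] h = ≤-trans (card-mono {S = S} {empty} (λ p → contradiction (h p) λ ())) (≤-reflexive (sum-0 n))
card≤length {n} S (x ∷ xs) h = begin
  card S                             ≡⟨ +-identityʳ (card S) ⟨
  card S + 0                         ≤⟨ +-monoʳ-≤ (card S) z≤n ⟩
  card S + card (empty {n})          ≤⟨ card-mono₂ S empty (singleton x) (S ∖ x) split (λ ()) (λ _ ()) ⟩
  card (singleton x) + card (S ∖ x)  ≡⟨ cong (_+ card (S ∖ x)) (card-singleton x) ⟩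
  suc (card (S ∖ x))                 ≤⟨ s≤s (card≤length (S ∖ x) xs smaller) ⟩
  suc (length xs)                    ∎
  where
  open ≤-Reasoning
  split : ∀ {y} → y ∈ S → y ∈ singleton x ⊎ y ∈ S ∖ x
  split {y} p with y ≟ x
  ... | yes _  = inj₁ refl
  ... | no y≢x = inj₂ (∈-∖⁺ S p y≢x)
  smaller : ∀ {y} → y ∈ S ∖ x → y ∈ˡ xs
  smaller p with ∈-∖⁻ S p
  ... | q , y≢x with h q
  ...   | here e  = contradiction e y≢x
  ...   | there r = r

length≤card : ∀ {n} (S : VSet n) {xs : List (Fin n)} → Unique xs → All (_∈ S) xs → length xs ≤ card S
length≤card S []       []       = z≤n
length≤card S {x ∷ xs} (x≢ ∷ u) (p ∷ ps) =
  ≤-<-trans (length≤card (S ∖ x) u (remove x≢ ps))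
    (card-mono-< {S = S ∖ x} {S} (proj₁ ∘ ∈-∖⁻ S) (λ q → proj₂ (∈-∖⁻ S q) refl) p)
  where
  remove : ∀ {ys} → All (x ≢_) ys → All (_∈ S) ys → All (_∈ (S ∖ x)) ys
  remove []       []       = []
  remove (d ∷ ds) (q ∷ qs) = ∈-∖⁺ S q (d ∘ ≡.sym) ∷ remove ds qs

0<card : ∀ {n} (S : VSet n) {x} → x ∈ S → 0 < card S
0<card S p = length≤card S ([] ∷ []) (p ∷ [])

0<card⁻ : ∀ {n} (S : VSet n) → 0 < card S → ∃ (_∈ S)
0<card⁻ S p with any? (_∈? S)
... | yes q = q
... | no ¬q = contradiction (card≤length S [] (λ {x} q → contradiction (x , q) ¬q)) (<⇒≱ p)

card-∩∪ : ∀ {n} (S T : VSet n) → card (S ∩ T) + card (S ∪ T) ≡ card S + card T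
card-∩∪ S T = ≤-antisym
  (card-mono₂ (S ∩ T) (S ∪ T) S T (inj₁ ∘ proj₁ ∘ ∈-∩⁻ S T) (∈-∪⁻ S T) (λ p _ → ∈-∩⁻ S T p))
  (card-mono₂ S T (S ∩ T) (S ∪ T) (inj₂ ∘ ∈-∪⁺ˡ S T) (inj₂ ∘ ∈-∪⁺ʳ S T)
    (λ p q → ∈-∩⁺ S T p q , ∈-∪⁺ˡ S T p))

card-bijective : ∀ {n} (S : VSet n) {σ : Fin n → Fin n} → Bijective _≡_ _≡_ σ → card (S ∘ σ) ≡ card S
card-bijective S {σ} (inj , surj) = ≡.sym (∑-permute (indicator ∘ S)
  (permutation σ (proj₁ ∘ surj) (λ y → proj₂ (surj y) refl) (λ x → inj (proj₂ (surj (σ x)) refl))))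

-- Vertex boundaries, submodularity and fragments

Adj-sym : ∀ {n} (G : Graph n) x y → Adj G x y → Adj G y x
Adj-sym G x y = trans (Graph.sym G y x)

module Neighbourhood {n} (G : Graph n) where

  deg : Fin n → ℕ
  deg u = card (adj G u)

  IsBoundary : VSet n → Fin n → Set
  IsBoundary S v = v ∉ S × ∃ λ u → u ∈ S × Adj G u v

  isBoundary? : ∀ S v → Dec (IsBoundary S v)
  isBoundary? S v = ¬? (v ∈? S) ×-dec any? (λ u → (u ∈? S) ×-dec (adj G u v Bool.≟ true))

  ∂ : VSet n → VSet n
  ∂ S = comprehend (isBoundary? S)

  ∂⁻ : ∀ S {v} → v ∈ ∂ S → IsBoundary S v
  ∂⁻ S = ∈-comprehend⁻ (isBoundary? S)

  ∂⁺ : ∀ S {v} → v ∉ S → ∀ {u} → u ∈ S → Adj G u v → v ∈ ∂ S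
  ∂⁺ S p q r = ∈-comprehend⁺ (isBoundary? S) (p , _ , q , r)

  outside? : ∀ S v → Dec (v ∉ S × v ∉ ∂ S)
  outside? S v = ¬? (v ∈? S) ×-dec ¬? (v ∈? ∂ S)

  outside : VSet n → VSet n
  outside S = comprehend (outside? S)

  outside⁻ : ∀ S {v} → v ∈ outside S → v ∉ S × v ∉ ∂ S
  outside⁻ S = ∈-comprehend⁻ (outside? S)

  outside⁺ : ∀ S {v} → v ∉ S → v ∉ ∂ S → v ∈ outside S
  outside⁺ S p q = ∈-comprehend⁺ (outside? S) (p , q)

  card-partition : ∀ S → card S + card (∂ S) + card (outside S) ≡ n
  card-partition S = ≤-antisym
    (begin
      card S + card (∂ S) + card (outside S)  ≤⟨ +-monoˡ-≤ (card (outside S)) (card-mono₂ S (∂ S) S∪∂S empty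
         (inj₁ ∘ ∈-∪⁺ˡ S (∂ S)) (inj₁ ∘ ∈-∪⁺ʳ S (∂ S)) (λ p q → contradiction p (proj₁ (∂⁻ S q)))) ⟩
      card S∪∂S + card (empty {n}) + card (outside S)  ≡⟨ cong (_+ card (outside S)) (trans (cong (card S∪∂S +_) (sum-0 n)) (+-identityʳ _)) ⟩
      card S∪∂S + card (outside S)  ≤⟨ card-mono₂ S∪∂S (outside S) (λ _ → true) empty (λ _ → inj₁ refl) (λ _ → inj₁ refl)
          (λ p q → ⊥-elim ([ proj₁ (outside⁻ S q) , proj₂ (outside⁻ S q) ]′ (∈-∪⁻ S (∂ S) p))) ⟩
      sum {n} (λ _ → 1) + card (empty {n})       ≡⟨ cong₂ _+_ (sum-1 n) (sum-0 n) ⟩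
      n + 0  ≡⟨ +-identityʳ n ⟩
      n ∎)
    (begin
      n  ≡⟨ +-identityʳ n ⟨
      n + 0  ≡⟨ cong₂ _+_ (sum-1 n) (sum-0 n) ⟨
      sum {n} (λ _ → 1) + card (empty {n})  ≤⟨ card-mono₂ (λ _ → true) empty S∪∂S (outside S) (λ _ → cover) (λ ()) (λ _ ()) ⟩
      card S∪∂S + card (outside S)  ≤⟨ +-monoˡ-≤ (card (outside S)) (≤-trans (m≤n+m _ (card (empty {n}))) (card-mono₂ empty S∪∂S S (∂ S) (λ ()) (∈-∪⁻ S (∂ S)) (λ ()))) ⟩
      card S + card (∂ S) + card (outside S) ∎)
    where
    open ≤-Reasoning
    S∪∂S = S ∪ ∂ S
    cover : ∀ {x} → x ∈ S∪∂S ⊎ x ∈ outside S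
    cover {x} with x ∈? S | x ∈? ∂ S
    ... | yes p | _     = inj₁ (∈-∪⁺ˡ S (∂ S) p)
    ... | no _  | yes q = inj₁ (∈-∪⁺ʳ S (∂ S) q)
    ... | no p  | no q  = inj₂ (outside⁺ S p q)

  -- When `S` grows to `T`, a boundary vertex is either absorbed or keeps its neighbour inside, so
  -- the closed neighbourhood can only grow.
  card-closed-mono : ∀ S T → S ⊆ T → card S + card (∂ S) ≤ card T + card (∂ T)
  card-closed-mono S T S⊆T = card-mono₂ S (∂ S) T (∂ T) (inj₁ ∘ S⊆T) boundary
    (λ p q → contradiction p (proj₁ (∂⁻ S q)))
    where
    boundary : ∀ {x} → x ∈ ∂ S → x ∈ T ⊎ x ∈ ∂ T
    boundary {x} p with x ∈? T
    ... | yes q = inj₁ q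
    ... | no ¬q = let _ , u , r , e = ∂⁻ S p in inj₂ (∂⁺ T ¬q (S⊆T r) e)

  -- A vertex in both boundaries on the left lies outside `S ∪ T` and has a neighbour in `S ∩ T`, so
  -- it is in `∂ S` and in `∂ T`. A vertex in just one of them still lies outside one of the sets
  -- while having a neighbour in it.
  submodular : ∀ S T → card (∂ (S ∩ T)) + card (∂ (S ∪ T)) ≤ card (∂ S) + card (∂ T)
  submodular S T = card-mono₂ (∂ (S ∩ T)) (∂ (S ∪ T)) (∂ S) (∂ T) meet join
    (λ p q → both p (proj₁ (∂⁻ (S ∪ T) q)))
    where
    join : ∀ {x} → x ∈ ∂ (S ∪ T) → x ∈ ∂ S ⊎ x ∈ ∂ T
    join p with ∂⁻ (S ∪ T) p
    ... | x∉ , u , u∈ , e with ∈-∪⁻ S T u∈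
    ...   | inj₁ q = inj₁ (∂⁺ S (x∉ ∘ ∈-∪⁺ˡ S T) q e)
    ...   | inj₂ q = inj₂ (∂⁺ T (x∉ ∘ ∈-∪⁺ʳ S T) q e)
    meet : ∀ {x} → x ∈ ∂ (S ∩ T) → x ∈ ∂ S ⊎ x ∈ ∂ T
    meet {x} p with ∂⁻ (S ∩ T) p | x ∈? S
    ... | x∉ , u , u∈ , e | yes q = inj₂ (∂⁺ T (x∉ ∘ ∈-∩⁺ S T q) (proj₂ (∈-∩⁻ S T u∈)) e)
    ... | x∉ , u , u∈ , e | no ¬q = inj₁ (∂⁺ S ¬q (proj₁ (∈-∩⁻ S T u∈)) e)
    both : ∀ {x} → x ∈ ∂ (S ∩ T) → x ∉ S ∪ T → x ∈ ∂ S × x ∈ ∂ T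
    both p x∉ with ∂⁻ (S ∩ T) p
    ... | _ , u , u∈ , e = ∂⁺ S (x∉ ∘ ∈-∪⁺ˡ S T) (proj₁ (∈-∩⁻ S T u∈)) e
                         , ∂⁺ T (x∉ ∘ ∈-∪⁺ʳ S T) (proj₂ (∈-∩⁻ S T u∈)) e

  -- An edge between `S` and its outside would put the outer end into `∂ S`.
  ∂-outside : ∀ S → ∂ (outside S) ⊆ ∂ S
  ∂-outside S {v} p with ∂⁻ (outside S) p | v ∈? ∂ S
  ... | _ | yes q = q
  ... | v∉ , u , u∈ , e | no ¬q with v ∈? S
  ...   | no ¬r = contradiction (outside⁺ S ¬r ¬q) v∉
  ...   | yes r = contradiction (∂⁺ S (proj₁ (outside⁻ S u∈)) r (Adj-sym G u v e)) (proj₂ (outside⁻ S u∈))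

  -- By `card-partition` the second condition amounts to a nonempty outside; as a count it passes
  -- along inequalities between cardinalities.
  Fragment : VSet n → Set
  Fragment S = 0 < card S × card S + card (∂ S) < n

  fragment : ∀ S {a b} → a ∈ S → b ∈ outside S → Fragment S
  fragment S a∈ b∈ = 0<card S a∈ , (begin-strict
    card S + card (∂ S)                     ≡⟨ +-identityʳ _ ⟨
    card S + card (∂ S) + 0                 <⟨ +-monoʳ-< (card S + card (∂ S)) (0<card (outside S) b∈) ⟩
    card S + card (∂ S) + card (outside S)  ≡⟨ card-partition S ⟩
    n                                       ∎)
    where open ≤-Reasoning

  fragment-outside : ∀ S → Fragment S → ∃ (_∈ outside S)
  fragment-outside S (_ , p) = 0<card⁻ (outside S) (+-cancelˡ-< (card S + card (∂ S)) 0 _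
    (subst₂ _<_ (≡.sym (+-identityʳ _)) (≡.sym (card-partition S)) p))

  leaving-edge : Connected G → ∀ S {u w} → u ∈ S → w ∉ S → ∃ λ a → ∃ λ b → a ∈ S × b ∉ S × Adj G a b
  leaving-edge conn S {u} {w} u∈ w∉ with conn u w
  ... | ℓ , P , refl , refl = along ℓ (vert P) (edges P) u∈ w∉
    where
    -- Distinctness is dropped so that the induction can pass to the tail of the walk; the edge
    -- sought is the first one leaving `S`.
    along : ∀ ℓ (v : Fin (suc ℓ) → Fin n) → (∀ j → Adj G (v (inject₁ j)) (v (Fin.suc j))) →
            v Fin.zero ∈ S → v (fromℕ ℓ) ∉ S → ∃ λ a → ∃ λ b → a ∈ S × b ∉ S × Adj G a b
    along zero    v e p q = contradiction p q
    along (suc ℓ) v e p q with v (Fin.suc Fin.zero) ∈? S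
    ... | yes r = along ℓ (v ∘ Fin.suc) (e ∘ Fin.suc) r q
    ... | no ¬r = _ , _ , p , ¬r , e Fin.zero

  deg-≤-closed : ∀ S {u} → u ∈ S → suc (deg u) ≤ card S + card (∂ S)
  deg-≤-closed S {u} u∈ = subst (λ z → z + deg u ≤ card S + card (∂ S)) (card-singleton u)
    (card-mono₂ (singleton u) (adj G u) S (∂ S) (λ {x} p → inj₁ (subst (_∈ S) (≡.sym (∈-singleton⁻ p)) u∈)) nbr
      (λ {x} p e → contradiction (trans (≡.sym (trans (cong (adj G u) (∈-singleton⁻ p)) (irref G u))) e) λ ()))
    where
    nbr : ∀ {x} → x ∈ adj G u → x ∈ S ⊎ x ∈ ∂ S
    nbr {x} e with x ∈? S
    ... | yes p = inj₁ p
    ... | no ¬p = inj₂ (∂⁺ S ¬p u∈ e)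

-- Atoms and the degree bound

module Atoms {n} (G : Graph n) (conn : Connected G) (vt : VertexTransitive G) where

  open Neighbourhood G

  deg-const : ∀ u v → deg u ≡ deg v
  deg-const u v with vt u v
  ... | σ , (bij , pres) , refl = trans (sum-cong-≋ (λ x → cong indicator (≡.sym (pres u x)))) (card-bijective (adj G (σ u)) bij)

  -- The parameters are only lower bounds, on boundaries and then on sizes of fragments with small
  -- boundary. That both are attained is what an `Atom` witnesses.
  module Minimal (κ a : ℕ)
    (κ-min : ∀ S → Fragment S → κ ≤ card (∂ S))
    (a-min : ∀ S → Fragment S → card (∂ S) ≤ κ → a ≤ card S) where

    record Atom (S : VSet n) : Set where
      field
        size     : card S ≡ a
        boundary : card (∂ S) ≤ κ
        frag     : Fragment S
    open Atom

    -- Otherwise X ∩ Y, smaller than an atom, has boundary larger than κ, so by submodularity that of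
    -- X ∪ Y is smaller than κ; hence X ∪ Y is no fragment, but it is too small to be anything else.
    uncross : ∀ X Y → card (∂ X) ≤ κ → card X + a + κ ≤ n → Atom Y → ∀ {z} → z ∈ X → z ∈ Y → Y ⊆ X
    uncross X Y ∂X≤κ fits atomY {z} z∈X z∈Y {y} y∈Y with y ∈? X
    ... | yes y∈X = y∈X
    ... | no y∉X  = contradiction n<n (<-irrefl refl)
      where
      open ≤-Reasoning
      I = X ∩ Y
      U = X ∪ Y
      0<I : 0 < card I
      0<I = 0<card I (∈-∩⁺ X Y z∈X z∈Y)
      I<a : card I < a
      I<a = subst (card I <_) (size atomY)
        (card-mono-< {S = I} {Y} (proj₂ ∘ ∈-∩⁻ X Y) (y∉X ∘ proj₁ ∘ ∈-∩⁻ X Y) y∈Y)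
      fragI : Fragment I
      fragI = 0<I , ≤-<-trans (card-closed-mono I Y (proj₂ ∘ ∈-∩⁻ X Y)) (proj₂ (frag atomY))
      κ<∂I : κ < card (∂ I)
      κ<∂I = ≰⇒> λ ∂I≤κ → <⇒≱ I<a (a-min I fragI ∂I≤κ)
      ∂U<κ : card (∂ U) < κ
      ∂U<κ = +-cancelˡ-< κ _ _ (begin-strict
        κ + card (∂ U)            <⟨ +-monoˡ-< (card (∂ U)) κ<∂I ⟩
        card (∂ I) + card (∂ U)   ≤⟨ submodular X Y ⟩
        card (∂ X) + card (∂ Y)   ≤⟨ +-mono-≤ ∂X≤κ (boundary atomY) ⟩
        κ + κ                     ∎)
      U≥n : n ≤ card U + card (∂ U)
      U≥n = ≮⇒≥ λ U<n → <⇒≱ ∂U<κ (κ-min U (0<card U (∈-∪⁺ˡ X Y z∈X) , U<n))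
      n<n : n < n
      n<n = begin-strict
        n                           ≤⟨ U≥n ⟩
        card U + card (∂ U)         <⟨ +-monoʳ-< (card U) ∂U<κ ⟩
        card U + κ                  ≤⟨ +-monoˡ-≤ κ (m≤n+m (card U) (card I)) ⟩
        card I + card U + κ         ≡⟨ cong (_+ κ) (card-∩∪ X Y) ⟩
        card X + card Y + κ         ≡⟨ cong (λ s → card X + s + κ) (size atomY) ⟩
        card X + a + κ              ≤⟨ fits ⟩
        n                           ∎

    -- The room that `uncross` asks for when its `X` is the outside of an atom: `S` and `∂ S`
    -- already occupy at least `a + κ` vertices.
    outside-fits : ∀ S → Atom S → card (outside S) + a + κ ≤ n
    outside-fits S atomS = begin
      card (outside S) + a + κ                 ≡⟨ +-assoc (card (outside S)) a κ ⟩
      card (outside S) + (a + κ)               ≤⟨ +-monoʳ-≤ (card (outside S)) (+-mono-≤ (≤-reflexive (≡.sym (size atomS))) (κ-min S (frag atomS))) ⟩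
      card (outside S) + (card S + card (∂ S)) ≡⟨ +-comm (card (outside S)) _ ⟩
      card S + card (∂ S) + card (outside S)   ≡⟨ card-partition S ⟩
      n                                        ∎
      where open ≤-Reasoning

    ∂-outside≤κ : ∀ S → Atom S → card (∂ (outside S)) ≤ κ
    ∂-outside≤κ S atomS = ≤-trans (card-mono {S = ∂ (outside S)} {∂ S} (∂-outside S)) (boundary atomS)

    -- The outside of an atom is itself a fragment with boundary at most `κ`, any vertex of `S`
    -- lying outside it in turn. Hence it is at least as large as `S`, and `outside-fits` applies.
    atom-fits : ∀ S → Atom S → card S + a + κ ≤ n
    atom-fits S atomS = ≤-trans (+-monoˡ-≤ κ (+-monoˡ-≤ a S≤outside)) (outside-fits S atomS)
      where
      a-outside : a ≤ card (outside S)
      a-outside with 0<card⁻ S (proj₁ (frag atomS)) | fragment-outside S (frag atomS)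
      ... | s , s∈ | t , t∈ = a-min (outside S) (fragment (outside S) t∈
            (outside⁺ (outside S) (λ p → proj₁ (outside⁻ S p) s∈) (λ p → proj₁ (∂⁻ S (∂-outside S p)) s∈)))
            (∂-outside≤κ S atomS)
      S≤outside : card S ≤ card (outside S)
      S≤outside = subst (_≤ card (outside S)) (≡.sym (size atomS)) a-outside

    -- Take an automorphism sending `v` into `S`: the preimage of `S` has the same size, and its
    -- boundary lies in the preimage of `∂ S`.
    atom-through : ∀ S → Atom S → ∀ v → ∃ λ B → Atom B × v ∈ B
    atom-through S atomS v with 0<card⁻ S (proj₁ (frag atomS))
    ... | s , s∈ with vt v s
    ...   | σ , (bij , pres) , refl = S ∘ σ , record
            { size     = trans (card-bijective S bij) (size atomS)
            ; boundary = ≤-trans ∂≤ (boundary atomS)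
            ; frag     = subst (0 <_) (≡.sym (card-bijective S bij)) (proj₁ (frag atomS))
                       , ≤-<-trans (+-mono-≤ (≤-reflexive (card-bijective S bij)) ∂≤) (proj₂ (frag atomS))
            } , s∈
      where
      ∂≤ : card (∂ (S ∘ σ)) ≤ card (∂ S)
      ∂≤ = subst (card (∂ (S ∘ σ)) ≤_) (card-bijective (∂ S) bij)
        (card-mono {S = ∂ (S ∘ σ)} {∂ S ∘ σ} λ p → let x∉ , u , u∈ , e = ∂⁻ (S ∘ σ) p in
          ∂⁺ S x∉ u∈ (trans (pres u _) e))

    -- If `B` met `S` or the outside of `S`, then `uncross` would place all of `B` there, including
    -- `v`, which is in `∂ S`.
    atom-in-boundary : ∀ S B → Atom S → Atom B → ∀ {v} → v ∈ ∂ S → v ∈ B → B ⊆ ∂ S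
    atom-in-boundary S B atomS atomB {v} v∈∂S v∈B {w} w∈B with w ∈? S | w ∈? ∂ S
    ... | _       | yes w∈∂S = w∈∂S
    ... | yes w∈S | no _     = contradiction
      (uncross S B (boundary atomS) (atom-fits S atomS) atomB w∈S w∈B v∈B) (proj₁ (∂⁻ S v∈∂S))
    ... | no w∉S  | no w∉∂S  = contradiction v∈∂S (proj₂ (outside⁻ S
      (uncross (outside S) B (∂-outside≤κ S atomS) (outside-fits S atomS) atomB (outside⁺ S w∉S w∉∂S) w∈B v∈B)))

    -- An edge leaving `S` yields an atom `B` inside `∂ S`. Either a vertex of `∂ S` beyond `B`
    -- yields a second, disjoint atom, or `∂ S` equals `B`; then `∂ B` equals `S`, and no edge
    -- leaves `S ∪ B`, although the outside of `S` is nonempty and `G` connected.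
    two-atoms-in-boundary : ∀ S → Atom S → a + a ≤ κ
    two-atoms-in-boundary S atomS with 0<card⁻ S (proj₁ (frag atomS)) | fragment-outside S (frag atomS)
    ... | s , s∈S | t , t∈out with leaving-edge conn S s∈S (proj₁ (outside⁻ S t∈out))
    ... | u , v , u∈S , v∉S , uv with atom-through S atomS v
    ... | B , atomB , v∈B with any? (λ w → (w ∈? ∂ S) ×-dec ¬? (w ∈? B))
    ... | yes (w , w∈∂S , w∉B) = two (atom-through S atomS w)
      where
      B⊆∂S : B ⊆ ∂ S
      B⊆∂S = atom-in-boundary S B atomS atomB (∂⁺ S v∉S u∈S uv) v∈B
      two : (∃ λ C → Atom C × w ∈ C) → a + a ≤ κ
      two (C , atomC , w∈C) = begin
        a + a                        ≡⟨ cong₂ _+_ (size atomB) (size atomC) ⟨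
        card B + card C              ≤⟨ card-mono₂ B C (∂ S) empty (inj₁ ∘ B⊆∂S)
                                          (inj₁ ∘ atom-in-boundary S C atomS atomC w∈∂S w∈C)
                                          -- A common vertex of `B` and `C` would force `C ⊆ B`, but
                                          -- `w` is in `C` only.
                                          (λ p q → contradiction (uncross B C (boundary atomB) (atom-fits B atomB) atomC p q w∈C) w∉B) ⟩
        card (∂ S) + card (empty {n}) ≡⟨ trans (cong (card (∂ S) +_) (sum-0 n)) (+-identityʳ _) ⟩
        card (∂ S)                   ≤⟨ boundary atomS ⟩
        κ                            ∎
        where open ≤-Reasoning
    ... | no ¬w = contradiction closed λ (p , q , p∈ , q∉ , pq) → [ fromS q∉ pq , fromB q∉ pq ]′ (∈-∪⁻ S B p∈)
      where
      B⊆∂S : B ⊆ ∂ S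
      B⊆∂S = atom-in-boundary S B atomS atomB (∂⁺ S v∉S u∈S uv) v∈B
      ∂S⊆B : ∂ S ⊆ B
      ∂S⊆B {w} w∈ with w ∈? B
      ... | yes p = p
      ... | no ¬p = contradiction (w , w∈ , ¬p) ¬w
      S⊆∂B : S ⊆ ∂ B
      S⊆∂B = atom-in-boundary B S atomB atomS
        (∂⁺ B (λ u∈B → proj₁ (∂⁻ S (B⊆∂S u∈B)) u∈S) v∈B (Adj-sym G u v uv)) u∈S
      -- With `S ⊆ ∂ B` known, this count turns the inclusion into an equality.
      ∂B≤S : card (∂ B) ≤ card S
      ∂B≤S = begin
        card (∂ B) ≤⟨ boundary atomB ⟩
        κ          ≤⟨ κ-min S (frag atomS) ⟩
        card (∂ S) ≤⟨ card-mono {S = ∂ S} {B} ∂S⊆B ⟩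
        card B     ≡⟨ trans (size atomB) (≡.sym (size atomS)) ⟩
        card S     ∎
        where open ≤-Reasoning
      ∂B⊆S : ∂ B ⊆ S
      ∂B⊆S {w} w∈ with w ∈? S
      ... | yes p = p
      ... | no ¬p = contradiction ∂B≤S (<⇒≱ (card-mono-< {S = S} {∂ B} S⊆∂B ¬p w∈))
      closed : ∃ λ p → ∃ λ q → p ∈ S ∪ B × q ∉ S ∪ B × Adj G p q
      closed = leaving-edge conn (S ∪ B) (∈-∪⁺ˡ S B u∈S)
        ([ proj₁ (outside⁻ S t∈out) , proj₂ (outside⁻ S t∈out) ∘ B⊆∂S ]′ ∘ ∈-∪⁻ S B)
      fromS : ∀ {p q} → q ∉ S ∪ B → Adj G p q → p ∉ S
      fromS q∉ pq p∈ = q∉ (∈-∪⁺ʳ S B (∂S⊆B (∂⁺ S (q∉ ∘ ∈-∪⁺ˡ S B) p∈ pq)))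
      fromB : ∀ {p q} → q ∉ S ∪ B → Adj G p q → p ∉ B
      fromB q∉ pq p∈ = q∉ (∈-∪⁺ˡ S B (∂B⊆S (∂⁺ B (q∉ ∘ ∈-∪⁺ʳ S B) p∈ pq)))

    deg≤κ : κ ≤ 3 → ∀ S → Atom S → ∀ u → deg u ≤ κ
    deg≤κ κ≤3 S atomS u with 0<card⁻ S (proj₁ (frag atomS))
    ... | s , s∈ = s≤s⁻¹ (begin
      suc (deg u)          ≡⟨ cong suc (deg-const u s) ⟩
      suc (deg s)          ≤⟨ deg-≤-closed S s∈ ⟩
      card S + card (∂ S)  ≤⟨ +-mono-≤ (≤-trans (≤-reflexive (size atomS)) a≤1) (boundary atomS) ⟩
      suc κ                ∎)
      where
      open ≤-Reasoning
      a≤1 : a ≤ 1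
      -- Atoms of size two or more would give `4 ≤ κ`.
      a≤1 = ≮⇒≥ λ 2≤a → <⇒≱ (+-mono-≤ 2≤a 2≤a) (≤-trans (two-atoms-in-boundary S atomS) κ≤3)

  -- A counterexample minimising first the boundary and then the size is an atom.
  deg≤boundary : ∀ S → Fragment S → card (∂ S) ≤ 3 → ∀ u → deg u ≤ card (∂ S)
  deg≤boundary S fragS ∂S≤3 u = go (<-wellFounded _) (<-wellFounded _) S fragS ∂S≤3 refl refl
    where
    Bounded : VSet n → Set
    Bounded S = Fragment S → card (∂ S) ≤ 3 → deg u ≤ card (∂ S)

    induct : ∀ S → (∀ T → card (∂ T) < card (∂ S) → Bounded T) →
             (∀ T → card (∂ T) ≡ card (∂ S) → card T < card S → Bounded T) → Bounded S
    induct S IH∂ IH fragS ∂S≤3 with deg u ≤? card (∂ S)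
    ... | yes p = p
    ... | no ¬p = deg≤κ ∂S≤3 S (record { size = refl ; boundary = ≤-refl ; frag = fragS }) u
      where
      κ-min : ∀ T → Fragment T → card (∂ S) ≤ card (∂ T)
      κ-min T fragT = ≮⇒≥ λ lt → ¬p (≤-trans (IH∂ T lt fragT (≤-trans (<⇒≤ lt) ∂S≤3)) (<⇒≤ lt))
      a-min : ∀ T → Fragment T → card (∂ T) ≤ card (∂ S) → card S ≤ card T
      a-min T fragT le = ≮⇒≥ λ lt → ¬p (≤-trans
        (IH T (≤-antisym le (κ-min T fragT)) lt fragT (≤-trans le ∂S≤3)) le)
      open Minimal (card (∂ S)) (card S) κ-min a-min

    go : ∀ {κ a} → Acc _<_ κ → Acc _<_ a → ∀ S → Fragment S → card (∂ S) ≤ 3 →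
         card (∂ S) ≡ κ → card S ≡ a → deg u ≤ card (∂ S)
    go (acc recκ) (acc reca) S fragS ∂S≤3 refl refl = induct S
      (λ T lt fragT ∂T≤3 → go (recκ lt) (<-wellFounded _) T fragT ∂T≤3 refl refl)
      (λ T eq lt fragT ∂T≤3 → go (acc recκ) (reca lt) T fragT ∂T≤3 eq refl) fragS ∂S≤3

-- Paths, cycles and separations

_∈ˡ?_ : ∀ {n} (x : Fin n) xs → Dec (x ∈ˡ xs)
_∈ˡ?_ = ∈ˡ-dec _≟_

next-inject₁ : ∀ {m} (i : Fin m) → next (inject₁ i) ≡ Fin.suc i
next-inject₁ {m} i = toℕ-injective (trans (toℕ-fromℕ< _)
  (trans (cong (λ z → suc z % suc m) (toℕ-inject₁ i)) (m<n⇒m%n≡m (s≤s (toℕ<n i)))))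

next-fromℕ : ∀ m → next (fromℕ m) ≡ Fin.zero
next-fromℕ m = toℕ-injective (trans (toℕ-fromℕ< _)
  (trans (cong (λ z → suc z % suc m) (toℕ-fromℕ m)) (n%n≡0 (suc m))))

module SimplePaths {n} (G : Graph n) where

  -- The list omits the first vertex, so the path is a ∷ xs.
  data SimplePath : Fin n → Fin n → List (Fin n) → Set where
    done : ∀ {a} → SimplePath a a []
    step : ∀ {a b c xs} → Adj G a b → a ∉ˡ b ∷ xs → SimplePath b c xs → SimplePath a c (b ∷ xs)

  lookup-injective : ∀ {a c xs} → SimplePath a c xs → Injective _≡_ _≡_ (lookup (a ∷ xs))
  lookup-injective p                {Fin.zero}  {Fin.zero}  _ = refl
  lookup-injective (step {xs = xs} _ a∉ p) {Fin.zero}  {Fin.suc j} e = contradiction (subst (_∈ˡ _ ∷ xs) (≡.sym e) (∈-lookup j)) a∉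
  lookup-injective (step {xs = xs} _ a∉ p) {Fin.suc i} {Fin.zero}  e = contradiction (subst (_∈ˡ _ ∷ xs) e (∈-lookup i)) a∉
  lookup-injective (step _ _ p)     {Fin.suc i} {Fin.suc j} e = cong Fin.suc (lookup-injective p e)

  lookup-edge : ∀ {a c xs} → SimplePath a c xs → ∀ i → Adj G (lookup (a ∷ xs) (inject₁ i)) (lookup xs i)
  lookup-edge (step e _ p) Fin.zero    = e
  lookup-edge (step _ _ p) (Fin.suc i) = lookup-edge p i

  lookup-last : ∀ {a c xs} → SimplePath a c xs → lookup (a ∷ xs) (fromℕ (length xs)) ≡ c
  lookup-last done         = refl
  lookup-last (step _ _ p) = lookup-last p

  data Consecutive (a b : Fin n) : List (Fin n) → Set where
    here  : ∀ {xs} → Consecutive a b (a ∷ b ∷ xs)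
    there : ∀ {x xs} → Consecutive a b xs → Consecutive a b (x ∷ xs)

  consecutive-index : ∀ {a b x xs} → Consecutive a b (x ∷ xs) →
    ∃ λ i → lookup (x ∷ xs) (inject₁ i) ≡ a × lookup xs i ≡ b
  consecutive-index here = Fin.zero , refl , refl
  consecutive-index {xs = _ ∷ _} (there q) = let i , e , f = consecutive-index q in Fin.suc i , e , f

  -- The list `a ∷ xs` is the cycle in order: `next` advances by one entry except at the last, `c`,
  -- where it wraps to `a` along the extra edge. The length bound supplies the three vertices a
  -- cycle needs.
  close : ∀ {a c xs} → SimplePath a c xs → Adj G c a → 2 ≤ length xs → Σ (Cycle G) λ C →
    (∀ {y} → y ∈ˡ a ∷ xs → ∃ λ i → cvert C i ≡ y) × CycleEdge C c a ×
    (∀ {y z} → Consecutive y z (a ∷ xs) → CycleEdge C y z)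
  close {xs = []}    p ca ()
  close {xs = _ ∷ []} p ca (s≤s ())
  close {a} {c} {xs@(_ ∷ _ ∷ _)} p ca _ = C , (λ y∈ → index y∈ , ≡.sym (lookup-index y∈)) ,
    (fromℕ _ , inj₁ (lookup-last p , cong (lookup (a ∷ xs)) (next-fromℕ _))) ,
    λ q → let i , e , f = consecutive-index q in
      inject₁ i , inj₁ (e , trans (cong (lookup (a ∷ xs)) (next-inject₁ i)) f)
    where
    closed-edge : ∀ i → Adj G (lookup (a ∷ xs) i) (lookup (a ∷ xs) (next i))
    closed-edge i with view i
    ... | ‵fromℕ     = subst₂ (Adj G) (≡.sym (lookup-last p)) (cong (lookup (a ∷ xs)) (≡.sym (next-fromℕ _))) ca
    ... | ‵inject₁ j = subst (Adj G _) (cong (lookup (a ∷ xs)) (≡.sym (next-inject₁ j))) (lookup-edge p j)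
    C : Cycle G
    C = record { len = _ ; cvert = lookup (a ∷ xs) ; cdistinct = lookup-injective p ; cedges = closed-edge }

  -- Glues a path given as a function in front of a list path starting at its end. The membership
  -- clause yields freshness in the induction; the last two clauses later show that the given path
  -- lies on the cycle.
  prepend : ∀ k (v : Fin (suc k) → Fin n) → Injective _≡_ _≡_ v →
    (∀ j → Adj G (v (inject₁ j)) (v (Fin.suc j))) → ∀ {z ys} → SimplePath (v (fromℕ k)) z ys →
    (∀ i → v (inject₁ i) ∉ˡ v (fromℕ k) ∷ ys) → ∃ λ xs → SimplePath (v Fin.zero) z xs ×
    length xs ≡ k + length ys ×
    (∀ {y} → y ∈ˡ v Fin.zero ∷ xs → y ∈ˡ v (fromℕ k) ∷ ys ⊎ ∃ λ i → y ≡ v i) ×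
    (∀ i → v i ∈ˡ v Fin.zero ∷ xs) ×
    (∀ j → Consecutive (v (inject₁ j)) (v (Fin.suc j)) (v Fin.zero ∷ xs))
  prepend zero v inj e {ys = ys} p v∉ = ys , p , refl , inj₁ , (λ { Fin.zero → here refl }) , λ ()
  prepend (suc k) v inj e p v∉
    with prepend k (v ∘ Fin.suc) (Finₚ.suc-injective ∘ inj) (e ∘ Fin.suc) p (v∉ ∘ Fin.suc)
  ... | xs , q , len , members , all , consec = v 1F ∷ xs , step (e Fin.zero) fresh q , cong suc len ,
    (λ { (here y≡) → inj₂ (Fin.zero , y≡)
       ; (there y∈) → [ inj₁ , (λ (i , y≡) → inj₂ (Fin.suc i , y≡)) ]′ (members y∈) }) ,
    (λ { Fin.zero → here refl ; (Fin.suc i) → there (all i) }) ,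
    (λ { Fin.zero → here ; (Fin.suc j) → there (consec j) })
    where
    fresh : v Fin.zero ∉ˡ v 1F ∷ xs
    fresh y∈ with members y∈
    ... | inj₁ q = v∉ Fin.zero q
    ... | inj₂ (i , eq) with () ← inj eq

  -- The path without its first vertex, followed by the return path, is a simple path from the
  -- second vertex to the first; the first edge of `P` closes it.
  closes-by : ∀ {k} (P : Path G (suc (suc k))) {ys} → SimplePath (vert P (fromℕ _)) (vert P Fin.zero) ys →
    (∀ (i : Fin (suc k)) → vert P (Fin.suc (inject₁ i)) ∉ˡ vert P (fromℕ _) ∷ ys) → ClosesToCycle P
  closes-by {k} P {ys} p v∉
    with prepend (suc k) (vert P ∘ Fin.suc) (Finₚ.suc-injective ∘ distinct P) (edges P ∘ Fin.suc) p v∉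
  ... | xs , q , len , members , all , consec =
    let C , on , closing , inner = close q (edges P Fin.zero)
                                     -- The return path is nonempty because the ends of `P` differ,
                                     -- and the tail of `P` has at least one edge.
                                     (subst (2 ≤_) (≡.sym len) (s≤s (≤-trans (nonempty p (λ e → contradiction (distinct P e) λ ())) (m≤n+m (length ys) k))))
    in C , (λ { Fin.zero → on₀ C closing ; (Fin.suc i) → on (all i) }) ,
       λ { Fin.zero → closing ; (Fin.suc j) → inner (consec j) }
    where
    nonempty : ∀ {a c ys} → SimplePath a c ys → a ≢ c → 1 ≤ length ys
    nonempty done         a≢ = contradiction refl a≢
    nonempty (step _ _ _) _  = s≤s z≤n
    on₀ : ∀ (C : Cycle G) {a b} → CycleEdge C a b → ∃ λ i → cvert C i ≡ a
    on₀ C (i , inj₁ (e , _)) = i , e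
    on₀ C (i , inj₂ (_ , e)) = next i , e

  open Neighbourhood G

  -- The component of `z` after deleting `X`: `link` is its connectedness, `enclosed` its
  -- maximality.
  record Component (X : VSet n) (z : Fin n) : Set where
    field
      set      : VSet n
      base     : z ∈ set
      avoids   : ∀ {s} → s ∈ set → s ∉ X
      link     : ∀ {s} → s ∈ set → ∃ λ xs → SimplePath s z xs × (∀ {y} → y ∈ˡ s ∷ xs → y ∈ set)
      enclosed : ∂ set ⊆ X

  component : ∀ X z → z ∉ X → Component X z
  component X z z∉X = grow n (singleton z) (m≤m+n n _) (x∈singleton z)
    (λ s∈ → subst (_∉ X) (≡.sym (∈-singleton⁻ s∈)) z∉X)
    (λ s∈ → [] , subst (λ s → SimplePath s z []) (≡.sym (∈-singleton⁻ s∈)) done ,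
            λ { (here refl) → s∈ })
    where
    -- One boundary vertex outside `X` is added at a time. The fuel bounds the number of vertices
    -- still missing, so at zero `S` is everything and cannot grow.
    grow : ∀ fuel S → n ≤ fuel + card S → z ∈ S → (∀ {s} → s ∈ S → s ∉ X) →
      (∀ {s} → s ∈ S → ∃ λ xs → SimplePath s z xs × (∀ {y} → y ∈ˡ s ∷ xs → y ∈ S)) → Component X z
    grow fuel S n≤ z∈ avoids link with any? (λ v → (v ∈? ∂ S) ×-dec ¬? (v ∈? X))
    ... | no ¬v = record { set = S ; base = z∈ ; avoids = avoids ; link = link ; enclosed = enclosed }
      where
      enclosed : ∂ S ⊆ X
      enclosed {v} v∈ with v ∈? X
      ... | yes p = p
      ... | no ¬p = contradiction (v , v∈ , ¬p) ¬v
    ... | yes (v , v∈∂S , v∉X) = continue fuel n≤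
      where
      S′ = S ∪ singleton v
      old : S ⊆ S′
      old = ∈-∪⁺ˡ S (singleton v)
      new : v ∈ S′
      new = ∈-∪⁺ʳ S (singleton v) (x∈singleton v)
      larger : card S < card S′
      larger = card-mono-< {S = S} {S′} old (proj₁ (∂⁻ S v∈∂S)) new
      avoids′ : ∀ {s} → s ∈ S′ → s ∉ X
      avoids′ s∈ with ∈-∪⁻ S (singleton v) s∈
      ... | inj₁ q = avoids q
      ... | inj₂ q = subst (_∉ X) (≡.sym (∈-singleton⁻ q)) v∉X
      link-v : ∃ λ xs → SimplePath v z xs × (∀ {y} → y ∈ˡ v ∷ xs → y ∈ S′)
      link-v with ∂⁻ S v∈∂S
      ... | v∉S , u , u∈S , uv with link u∈S
      ...   | xs , p , xs⊆S = u ∷ xs , step (Adj-sym G u v uv) (v∉S ∘ xs⊆S) p ,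
              λ { (here refl) → new ; (there y∈) → old (xs⊆S y∈) }
      link′ : ∀ {s} → s ∈ S′ → ∃ λ xs → SimplePath s z xs × (∀ {y} → y ∈ˡ s ∷ xs → y ∈ S′)
      link′ s∈ with ∈-∪⁻ S (singleton v) s∈
      ... | inj₁ q = let xs , p , xs⊆S = link q in xs , p , old ∘ xs⊆S
      ... | inj₂ q = subst (λ s → ∃ λ xs → SimplePath s z xs × (∀ {y} → y ∈ˡ s ∷ xs → y ∈ S′)) (≡.sym (∈-singleton⁻ q)) link-v
      continue : ∀ fuel → n ≤ fuel + card S → Component X z
      continue zero       n≤ = contradiction (≤-trans (s≤s n≤) larger) (≤⇒≯ (card≤n S′))
      continue (suc fuel) n≤ = grow fuel S′
        (≤-trans (subst (n ≤_) (≡.sym (+-suc fuel (card S))) n≤) (+-monoʳ-≤ fuel larger))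
        (old z∈) avoids′ link′

  -- Symmetric in the two sides, so that whatever is shown for `S` holds for `T` via `swap`.
  record Separation (X : VSet n) : Set where
    field
      S T       : VSet n
      disjoint  : ∀ {x} → x ∈ S → x ∉ T
      S-avoids  : ∀ {x} → x ∈ S → x ∉ X
      T-avoids  : ∀ {x} → x ∈ T → x ∉ X
      ∂S⊆X      : ∂ S ⊆ X
      ∂T⊆X      : ∂ T ⊆ X
      S-frag    : Fragment S
      T-frag    : Fragment T

  -- Compare `b` with the component of `a` off `X`. If `b` is not in it, the sides are that
  -- component and everything else off `X`, and each of `a`, `b` shows that the opposite side is a
  -- fragment.
  linked-or-separated : ∀ X {a b} → a ∉ X → b ∉ X →
    (∃ λ xs → SimplePath b a xs × (∀ {y} → y ∈ˡ b ∷ xs → y ∉ X)) ⊎ Separation X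
  linked-or-separated X {a} {b} a∉X b∉X with component X a a∉X
  ... | record { set = S ; base = a∈S ; avoids = avoids ; link = link ; enclosed = ∂S⊆X } with b ∈? S
  ... | yes b∈S = let xs , p , xs⊆S = link b∈S in inj₁ (xs , p , avoids ∘ xs⊆S)
  ... | no b∉S  = inj₂ (record
    { S = S ; T = T
    ; disjoint = λ x∈S x∈T → proj₁ (T⁻ x∈T) x∈S
    ; S-avoids = avoids
    ; T-avoids = proj₂ ∘ T⁻
    ; ∂S⊆X = ∂S⊆X
    ; ∂T⊆X = ∂T⊆X
    ; S-frag = fragment S a∈S (outside⁺ S b∉S (b∉X ∘ ∂S⊆X))
    ; T-frag = fragment T (T⁺ (b∉S , b∉X)) (outside⁺ T (λ a∈T → proj₁ (T⁻ a∈T) a∈S) (a∉X ∘ ∂T⊆X))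
    })
    where
    T? : ∀ x → Dec (x ∉ S × x ∉ X)
    T? x = ¬? (x ∈? S) ×-dec ¬? (x ∈? X)
    T = comprehend T?
    T⁻ : ∀ {x} → x ∈ T → x ∉ S × x ∉ X
    T⁻ = ∈-comprehend⁻ T?
    T⁺ : ∀ {x} → x ∉ S × x ∉ X → x ∈ T
    T⁺ = ∈-comprehend⁺ T?
    ∂T⊆X : ∂ T ⊆ X
    ∂T⊆X {x} x∈ with ∂⁻ T x∈ | x ∈? X | x ∈? S
    ... | _                  | yes x∈X | _       = x∈X
    ... | x∉T , _            | no x∉X  | no x∉S  = contradiction (T⁺ (x∉S , x∉X)) x∉T
    ... | _ , u , u∈T , ux   | no _    | yes x∈S =
      contradiction (∂S⊆X (∂⁺ S (proj₁ (T⁻ u∈T)) x∈S (Adj-sym G u x ux))) (proj₂ (T⁻ u∈T))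

-- Closing paths of length at most four

module Closing {n} (3≤n : 3 ≤ n) (G : Graph n) (conn : Connected G) (vt : VertexTransitive G) where

  open Neighbourhood G
  open SimplePaths G
  open Atoms G conn vt

  swap : ∀ {X} → Separation X → Separation X
  swap sep = record
    { S = T ; T = S ; disjoint = λ p q → disjoint q p ; S-avoids = T-avoids ; T-avoids = S-avoids
    ; ∂S⊆X = ∂T⊆X ; ∂T⊆X = ∂S⊆X ; S-frag = T-frag ; T-frag = S-frag }
    where open Separation sep

  module _ {X : VSet n} (sep : Separation X) where
    open Separation sep

    neighbour-in : ∀ {x} R → x ∈ ∂ R → ∃ λ r → r ∈ R × Adj G x r
    neighbour-in {x} R p = let _ , r , r∈ , e = ∂⁻ R p in r , r∈ , Adj-sym G r x e

    -- The neighbours exhibited lie in `S`, `T` and `X`, which are pairwise disjoint; the next two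
    -- bounds vary how many come from each.
    3≤deg : ∀ {x y} → x ∈ ∂ S → x ∈ ∂ T → y ∈ X → Adj G x y → 3 ≤ deg x
    3≤deg {x} x∈S x∈T y∈X xy with neighbour-in S x∈S | neighbour-in T x∈T
    ... | s , s∈ , xs | t , t∈ , xt = length≤card (adj G x)
      (((λ { refl → disjoint s∈ t∈ }) ∷ (λ { refl → S-avoids s∈ y∈X }) ∷ [])
        ∷ ((λ { refl → T-avoids t∈ y∈X }) ∷ []) ∷ [] ∷ []) (xs ∷ xt ∷ xy ∷ [])

    4≤deg : ∀ {x y z} → x ∈ ∂ S → x ∈ ∂ T → y ∈ X → z ∈ X → y ≢ z → Adj G x y → Adj G x z → 4 ≤ deg x
    4≤deg {x} x∈S x∈T y∈X z∈X y≢z xy xz with neighbour-in S x∈S | neighbour-in T x∈T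
    ... | s , s∈ , xs | t , t∈ , xt = length≤card (adj G x)
      (((λ { refl → disjoint s∈ t∈ }) ∷ (λ { refl → S-avoids s∈ y∈X }) ∷ (λ { refl → S-avoids s∈ z∈X }) ∷ [])
        ∷ ((λ { refl → T-avoids t∈ y∈X }) ∷ (λ { refl → T-avoids t∈ z∈X }) ∷ [])
        ∷ (y≢z ∷ []) ∷ [] ∷ []) (xs ∷ xt ∷ xy ∷ xz ∷ [])

    3≤deg′ : ∀ {x y z} → x ∈ ∂ S → y ∈ X → z ∈ X → y ≢ z → Adj G x y → Adj G x z → 3 ≤ deg x
    3≤deg′ {x} x∈S y∈X z∈X y≢z xy xz with neighbour-in S x∈S
    ... | s , s∈ , xs = length≤card (adj G x)
      (((λ { refl → S-avoids s∈ y∈X }) ∷ (λ { refl → S-avoids s∈ z∈X }) ∷ [])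
        ∷ (y≢z ∷ []) ∷ [] ∷ []) (xs ∷ xy ∷ xz ∷ [])

  2≤deg : ∀ {x y z} → y ≢ z → Adj G x y → Adj G x z → 2 ≤ deg x
  2≤deg {x} y≢z xy xz = length≤card (adj G x) ((y≢z ∷ []) ∷ [] ∷ []) (xy ∷ xz ∷ [])

  saturated : ∀ (R : VSet n) {x xs} → (∀ {y} → y ∈ R → y ∈ˡ x ∷ xs) → suc (length xs) ≤ card R → x ∈ R
  saturated R {x} {xs} R⊆ le with x ∈? R
  ... | yes p = p
  ... | no ¬p = contradiction (card≤length R xs rest) (<⇒≱ le)
    where
    rest : ∀ {y} → y ∈ R → y ∈ˡ xs
    rest y∈ with R⊆ y∈
    ... | here refl = contradiction y∈ ¬p
    ... | there q   = q

  module _ {X : VSet n} (sep : Separation X) where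
    open Separation sep

    private
      ∂S-length : ∀ {xs} → (∀ {y} → y ∈ X → y ∈ˡ xs) → card (∂ S) ≤ length xs
      ∂S-length h = card≤length (∂ S) _ (h ∘ ∂S⊆X)

    deg≤length : ∀ {xs} → (∀ {y} → y ∈ X → y ∈ˡ xs) → length xs ≤ 3 → ∀ u → deg u ≤ length xs
    deg≤length h le u = ≤-trans (deg≤boundary S S-frag (≤-trans (∂S-length h) le) u) (∂S-length h)

    -- The boundary has at least as many vertices as the degree. If the degree reaches the length of
    -- the list of candidates, each candidate must occur, in particular the head.
    saturated-S : ∀ {x xs} → (∀ {y} → y ∈ ∂ S → y ∈ˡ x ∷ xs) → length xs ≤ 2 → ∀ {u} → suc (length xs) ≤ deg u → x ∈ ∂ S
    saturated-S h le {u} d = saturated (∂ S) h (≤-trans d (deg≤boundary S S-frag (≤-trans (card≤length (∂ S) _ h) (s≤s le)) u))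

  separator-1 : ∀ {X} → Separation X → ∀ {x₀ x₁ x₂} → Adj G x₁ x₀ → Adj G x₁ x₂ → x₀ ≢ x₂ →
    (∀ {y} → y ∈ X → y ∈ˡ x₁ ∷ []) → ⊥
  separator-1 sep {x₁ = x₁} e₀ e₂ ne h = <⇒≱ (2≤deg ne e₀ e₂) (deg≤length sep h (s≤s z≤n) x₁)


  -- Degree two makes both boundaries fill their two candidates, so `x` has a neighbour on each
  -- side; `y` is a third one.
  two-attached : ∀ {X} (sep : Separation X) {x x′ y} →
    (∀ {w} → w ∈ ∂ (Separation.S sep) → w ∈ˡ x ∷ x′ ∷ []) → (∀ {w} → w ∈ ∂ (Separation.T sep) → w ∈ˡ x ∷ x′ ∷ []) →
    2 ≤ deg x → deg x ≤ 2 → y ∈ X → Adj G x y → ⊥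
  two-attached sep hS hT 2≤ ≤2 y∈X xy = <⇒≱ (3≤deg sep (saturated-S sep hS (s≤s z≤n) 2≤)
    (saturated-S (swap sep) hT (s≤s z≤n) 2≤) y∈X xy) ≤2

  separator-2 : ∀ {X} → Separation X → ∀ {x₀ x₁ x₂} → Adj G x₁ x₀ → Adj G x₁ x₂ → x₀ ≢ x₂ → x₂ ∈ X →
    (∀ {y} → y ∈ X → y ∈ˡ x₁ ∷ x₂ ∷ []) → ⊥
  separator-2 sep e₀ e₂ ne x₂∈X h = two-attached sep (h ∘ Separation.∂S⊆X sep) (h ∘ Separation.∂T⊆X sep)
    (2≤deg ne e₀ e₂) (deg≤length sep h (s≤s (s≤s z≤n)) _) x₂∈X e₂

  -- If the middle vertex has degree at least three, both boundaries use all three inner vertices,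
  -- and it has two neighbours in `X` and one on each side, against the bound 3. Otherwise its
  -- neighbours are just `x₁` and `x₃`, so it is in neither boundary, all degrees are at most two,
  -- and `two-attached` applies to `x₁`.
  separator-3 : ∀ {X} → Separation X → ∀ {x₀ x₁ x₂ x₃} → Adj G x₁ x₀ → Adj G x₁ x₂ → Adj G x₂ x₃ →
    x₀ ≢ x₂ → x₁ ≢ x₃ → x₁ ∈ X → x₂ ∈ X → x₃ ∈ X → (∀ {y} → y ∈ X → y ∈ˡ x₁ ∷ x₂ ∷ x₃ ∷ []) → ⊥
  separator-3 {X} sep {x₀} {x₁} {x₂} {x₃} e₁₀ e₁₂ e₂₃ x₀≢x₂ x₁≢x₃ x₁∈X x₂∈X x₃∈X h with deg x₂ ≤? 2
  ... | no ¬p = <⇒≱ (4≤deg sep (attached sep) (attached (swap sep)) x₁∈X x₃∈X x₁≢x₃ e₂₁ e₂₃)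
                    (deg≤length sep h ≤-refl x₂)
    where
    e₂₁ = Adj-sym G x₁ x₂ e₁₂
    first : ∀ {y} → y ∈ˡ x₁ ∷ x₂ ∷ x₃ ∷ [] → y ∈ˡ x₂ ∷ x₁ ∷ x₃ ∷ []
    first (here e)         = there (here e)
    first (there (here e)) = here e
    first (there (there q)) = there (there q)
    attached : (sep : Separation X) → x₂ ∈ ∂ (Separation.S sep)
    attached sep = saturated-S sep (first ∘ h ∘ Separation.∂S⊆X sep) ≤-refl (≰⇒> ¬p)
  ... | yes p = two-attached sep (detached sep) (detached (swap sep)) (2≤deg x₀≢x₂ e₁₀ e₁₂)
                  -- Regularity carries the bound from `x₂` to `x₁`.
                  (subst (_≤ 2) (deg-const x₂ x₁) p) x₂∈X e₁₂
    where
    e₂₁ = Adj-sym G x₁ x₂ e₁₂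
    detached : (sep : Separation X) → ∀ {y} → y ∈ ∂ (Separation.S sep) → y ∈ˡ x₁ ∷ x₃ ∷ []
    detached sep y∈ with h (Separation.∂S⊆X sep y∈)
    ... | here e            = here e
    ... | there (there q)   = there q
    ... | there (here refl) = contradiction p (<⇒≱ (3≤deg′ sep y∈ x₁∈X x₃∈X x₁≢x₃ e₂₁ e₂₃))

  module _ {k} (P : Path G (suc (suc k))) where

    inner : Fin (suc k) → Fin n
    inner i = vert P (Fin.suc (inject₁ i))

    isInner? : ∀ y → Dec (∃ λ i → y ≡ inner i)
    isInner? y = any? λ i → y ≟ inner i

    Inner : VSet n
    Inner = comprehend isInner?

    inner∈ : ∀ i → inner i ∈ Inner
    inner∈ i = ∈-comprehend⁺ isInner? (i , refl)

    Inner⁻ : ∀ {y} → y ∈ Inner → ∃ λ i → y ≡ inner i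
    Inner⁻ = ∈-comprehend⁻ isInner?

    Inner⊆ : ∀ {y} → y ∈ Inner → y ∈ˡ tabulate inner
    Inner⊆ y∈ with Inner⁻ y∈
    ... | i , refl = ∈-tabulate⁺ {f = inner} i

    -- A return path avoiding the inner vertices completes `P` to a cycle; if there is none, the
    -- inner vertices separate its ends.
    closes-or-separates : ClosesToCycle P ⊎ Separation Inner
    closes-or-separates with linked-or-separated Inner {vert P Fin.zero} {vert P (fromℕ _)} start end
      where
      start : vert P Fin.zero ∉ Inner
      start p with Inner⁻ p
      ... | i , e with () ← distinct P e
      end : vert P (fromℕ _) ∉ Inner
      end p with Inner⁻ p
      ... | i , e = contradiction (distinct P e) Finₚ.fromℕ≢inject₁
    ... | inj₁ (xs , p , avoids) = inj₁ (closes-by P p (λ i q → avoids q (inner∈ i)))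
    ... | inj₂ sep               = inj₂ sep

  vert≢ : ∀ {ℓ} (P : Path G ℓ) {i j} → i ≢ j → vert P i ≢ vert P j
  vert≢ P ne = ne ∘ distinct P

  back : ∀ {ℓ} (P : Path G ℓ) j → Adj G (vert P (Fin.suc j)) (vert P (inject₁ j))
  back P j = Adj-sym G (vert P (inject₁ j)) (vert P (Fin.suc j)) (edges P j)

  closes-2 : (P : Path G 2) → ClosesToCycle P
  closes-2 P with closes-or-separates P
  ... | inj₁ c   = c
  ... | inj₂ sep = ⊥-elim (separator-1 sep {v 0F} {v 1F} {v 2F} (back P 0F) (edges P 1F) (vert≢ P λ ()) (Inner⊆ P))
    where v = vert P

  closes-3 : (P : Path G 3) → ClosesToCycle P
  closes-3 P with closes-or-separates P
  ... | inj₁ c   = c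
  ... | inj₂ sep = ⊥-elim (separator-2 sep {v 0F} {v 1F} {v 2F}
                     (back P 0F) (edges P 1F) (vert≢ P λ ()) (inner∈ P 1F) (Inner⊆ P))
    where v = vert P

  closes-4 : (P : Path G 4) → ClosesToCycle P
  closes-4 P with closes-or-separates P
  ... | inj₁ c   = c
  ... | inj₂ sep = ⊥-elim (separator-3 sep {v 0F} {v 1F} {v 2F} {v 3F}
                     (back P 0F) (edges P 1F) (edges P 2F) (vert≢ P λ ()) (vert≢ P λ ())
                     (inner∈ P 0F) (inner∈ P 1F) (inner∈ P 2F) (Inner⊆ P))
    where v = vert P

  path-2 : ∀ {a b c} → Adj G a b → Adj G b c → a ≢ c → Path G 2
  path-2 {a} {b} {c} ab bc a≢c = record
    { vert     = λ { 0F → a ; 1F → b ; 2F → c }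
    ; distinct = λ { {0F} {0F} _ → refl ; {1F} {1F} _ → refl ; {2F} {2F} _ → refl
                   ; {0F} {1F} e → contradiction e (Adj⇒≢ ab) ; {1F} {0F} e → contradiction (≡.sym e) (Adj⇒≢ ab)
                   ; {1F} {2F} e → contradiction e (Adj⇒≢ bc) ; {2F} {1F} e → contradiction (≡.sym e) (Adj⇒≢ bc)
                   ; {0F} {2F} e → contradiction e a≢c ; {2F} {0F} e → contradiction (≡.sym e) a≢c }
    ; edges    = λ { 0F → ab ; 1F → bc }
    }
    where
    Adj⇒≢ : ∀ {x y} → Adj G x y → x ≢ y
    Adj⇒≢ {x} e refl with () ← trans (≡.sym (irref G x)) e

  -- The hypothesis `3 ≤ n` enters here.
  missing : ∀ (xs : List (Fin n)) → length xs ≤ 2 → ∃ λ (w : Fin n) → w ∉ˡ xs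
  missing xs le with any? (λ w → ¬? (w ∈ˡ? xs))
  ... | yes q = q
  ... | no ¬q = contradiction (≤-trans 3≤n (subst (_≤ length xs) (sum-1 n) (card≤length (λ _ → true) xs (λ {x} _ → all x)))) (<⇒≱ (s≤s le))
    where
    all : ∀ x → x ∈ˡ xs
    all x with x ∈ˡ? xs
    ... | yes p = p
    ... | no ¬p = contradiction (x , ¬p) ¬q

  leaves : ∀ (xs : List (Fin n)) {x} → x ∈ˡ xs → length xs ≤ 2 → ∃ λ a → ∃ λ b → a ∈ˡ xs × b ∉ˡ xs × Adj G a b
  leaves xs x∈ le with missing xs le
  ... | w , w∉ with leaving-edge conn (comprehend (_∈ˡ? xs)) (∈-comprehend⁺ (_∈ˡ? xs) x∈) (w∉ ∘ ∈-comprehend⁻ (_∈ˡ? xs))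
  ...   | a , b , a∈ , b∉ , ab = a , b , ∈-comprehend⁻ (_∈ˡ? xs) a∈ , b∉ ∘ ∈-comprehend⁺ (_∈ˡ? xs) , ab

  -- By connectedness some third vertex is adjacent to `x` or to `y`; it extends the edge to a path
  -- of length two, which closes.
  edge-on-cycle : ∀ {x y} → Adj G x y → Σ (Cycle G) λ C →
    (∃ λ i → cvert C i ≡ x) × (∃ λ i → cvert C i ≡ y) × CycleEdge C x y
  edge-on-cycle {x} {y} xy with leaves (x ∷ y ∷ []) (here refl) ≤-refl
  ... | _ , b , here refl , b∉ , xb =
    let C , on , es = closes-2 (path-2 (Adj-sym G x b xb) xy (λ b≡y → b∉ (there (here b≡y)))) in C , on 1F , on 2F , es 1F
  ... | _ , b , there (here refl) , b∉ , yb =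
    let C , on , es = closes-2 (path-2 xy yb (λ x≡b → b∉ (here (≡.sym x≡b)))) in C , on 0F , on 1F , es 0F

  closes-1 : (P : Path G 1) → ClosesToCycle P
  closes-1 P = let C , onx , ony , e = edge-on-cycle (edges P 0F) in
    C , (λ { 0F → onx ; 1F → ony }) , λ { 0F → e }

  closes-0 : (P : Path G 0) → ClosesToCycle P
  closes-0 P with leaves (vert P 0F ∷ []) (here refl) (s≤s z≤n)
  ... | _ , y , here refl , _ , xy = let C , onx , _ = edge-on-cycle xy in C , (λ { 0F → onx }) , λ ()

  closes : ∀ ℓ → ℓ ≤ 4 → (P : Path G ℓ) → ClosesToCycle P
  closes 0 _ = closes-0
  closes 1 _ = closes-1
  closes 2 _ = closes-2
  closes 3 _ = closes-3
  closes 4 _ = closes-4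
  closes (suc (suc (suc (suc (suc _))))) (s≤s (s≤s (s≤s (s≤s ()))))

-- Squares of cycles

module Cyclic (m : ℕ) where

  rot : ℕ → Fin (suc m) → Fin (suc m)
  rot zero    x = x
  rot (suc k) x = next (rot k x)

  -- The residue of `k`, built by iteration so that `next (at k)` is `at (suc k)` by definition.
  at : ℕ → Fin (suc m)
  at k = rot k Fin.zero

  toℕ-at : ∀ k → k < suc m → toℕ (at k) ≡ k
  toℕ-at zero    _ = refl
  toℕ-at (suc k) p = trans (toℕ-fromℕ< _)
    (trans (cong (λ z → suc z % suc m) (toℕ-at k (<⇒≤ p))) (m<n⇒m%n≡m p))

  at-toℕ : ∀ x → at (toℕ x) ≡ x
  at-toℕ x = toℕ-injective (toℕ-at (toℕ x) (toℕ<n x))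

  at-injective : ∀ {j k} → j < suc m → k < suc m → at j ≡ at k → j ≡ k
  at-injective p q e = trans (≡.sym (toℕ-at _ p)) (trans (cong toℕ e) (toℕ-at _ q))

  rot-+ : ∀ j k x → rot (j + k) x ≡ rot j (rot k x)
  rot-+ zero    k x = refl
  rot-+ (suc j) k x = cong next (rot-+ j k x)

  rot-next : ∀ k x → rot k (next x) ≡ next (rot k x)
  rot-next zero    x = refl
  rot-next (suc k) x = cong next (rot-next k x)

  at-period : at (suc m) ≡ Fin.zero
  at-period = toℕ-injective (trans (toℕ-fromℕ< _)
    (trans (cong (λ z → suc z % suc m) (toℕ-at m ≤-refl)) (n%n≡0 (suc m))))

  rot-period : ∀ x → rot (suc m) x ≡ x
  rot-period x = begin
    rot (suc m) x                 ≡⟨ cong (rot (suc m)) (at-toℕ x) ⟨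
    rot (suc m) (at (toℕ x))      ≡⟨ rot-+ (suc m) (toℕ x) Fin.zero ⟨
    at (suc m + toℕ x)            ≡⟨ cong at (+-comm (suc m) (toℕ x)) ⟩
    at (toℕ x + suc m)            ≡⟨ rot-+ (toℕ x) (suc m) Fin.zero ⟩
    rot (toℕ x) (at (suc m))      ≡⟨ cong (rot (toℕ x)) at-period ⟩
    at (toℕ x)                    ≡⟨ at-toℕ x ⟩
    x                             ∎
    where open ≡-Reasoning

  next-injective : Injective _≡_ _≡_ (next {m})
  next-injective {x} {y} e = trans (≡.sym (rot-period x)) (trans (≡.sym (rot-next m x))
    (trans (cong (rot m) e) (trans (rot-next m y) (rot-period y))))

  rot-injective : ∀ k → Injective _≡_ _≡_ (rot k)
  rot-injective zero    e = e
  rot-injective (suc k) e = rot-injective k (next-injective e)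

  prev : Fin (suc m) → Fin (suc m)
  prev = rot m

  next-prev : ∀ x → next (prev x) ≡ x
  next-prev = rot-period

  -- Rotate `u` on to zero by the complement of its label, then zero to `v`.
  rot-transitive : ∀ u v → ∃ λ k → rot k u ≡ v
  rot-transitive u v = toℕ v + (suc m ∸ toℕ u) , (begin
    rot (toℕ v + (suc m ∸ toℕ u)) u               ≡⟨ rot-+ (toℕ v) _ u ⟩
    rot (toℕ v) (rot (suc m ∸ toℕ u) u)           ≡⟨ cong (rot (toℕ v) ∘ rot (suc m ∸ toℕ u)) (at-toℕ u) ⟨
    rot (toℕ v) (rot (suc m ∸ toℕ u) (at (toℕ u))) ≡⟨ cong (rot (toℕ v)) (rot-+ (suc m ∸ toℕ u) (toℕ u) Fin.zero) ⟨
    rot (toℕ v) (at (suc m ∸ toℕ u + toℕ u))      ≡⟨ cong (rot (toℕ v) ∘ at) (m∸n+n≡m (<⇒≤ (toℕ<n u))) ⟩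
    rot (toℕ v) (at (suc m))                      ≡⟨ cong (rot (toℕ v)) at-period ⟩
    at (toℕ v)                                    ≡⟨ at-toℕ v ⟩
    v                                             ∎)
    where open ≡-Reasoning

  rot-bijective : ∀ k → Bijective _≡_ _≡_ (rot k)
  rot-bijective k = rot-injective k , λ y → let j , e = rot-transitive (rot k y) y in
    rot j y , λ { refl → trans (≡.sym (rot-+ k j y)) (trans (cong (λ z → rot z y) (+-comm k j))
      (trans (rot-+ j k y) e)) }

  -- A fixed point could be rotated to zero, and there the labels `suc k` and 0 differ.
  rot≢ : ∀ k x → suc k < suc m → rot (suc k) x ≢ x
  rot≢ k x p e with rot-transitive x Fin.zero
  ... | j , q with at-injective p (s≤s z≤n) (begin
      rot (suc k) Fin.zero ≡⟨ cong (rot (suc k)) q ⟨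
      rot (suc k) (rot j x) ≡⟨ rot-+ (suc k) j x ⟨
      rot (suc k + j) x ≡⟨ cong (λ z → rot z x) (+-comm (suc k) j) ⟩
      rot (j + suc k) x ≡⟨ rot-+ j (suc k) x ⟩
      rot j (rot (suc k) x) ≡⟨ cong (rot j) e ⟩
      rot j x ≡⟨ q ⟩
      Fin.zero ∎)
    where open ≡-Reasoning
  ... | ()

-- Neighbours on a cycle

cycle-next≢prev : ∀ {n} {G : Graph n} (C : Cycle G) i →
                  cvert C (next i) ≢ cvert C (Cyclic.prev _ i)
-- Equality would make two steps of `next` return to their start, which takes a cycle of length at
-- most two.
cycle-next≢prev C i e = rot≢ 1 (prev i) (s≤s (s≤s (s≤s z≤n)))
  (trans (cong next (next-prev i)) (cdistinct C e))
  where open Cyclic (suc (suc (len C)))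

CycleEdge-sym : ∀ {n} {G : Graph n} (C : Cycle G) {a b} → CycleEdge C a b → CycleEdge C b a
CycleEdge-sym C (i , inj₁ p) = i , inj₂ p
CycleEdge-sym C (i , inj₂ p) = i , inj₁ p

cycle-neighbours : ∀ {n} {G : Graph n} (C : Cycle G) i {a} → CycleEdge C (cvert C i) a →
                   a ≡ cvert C (next i) ⊎ a ≡ cvert C (Cyclic.prev _ i)
cycle-neighbours C i (j , inj₁ (p , q)) =
  inj₁ (trans (≡.sym q) (cong (cvert C ∘ next) (cdistinct C p)))
cycle-neighbours C i (j , inj₂ (p , q)) = inj₂ (trans (≡.sym p) (cong (cvert C)
  (next-injective (trans (cdistinct C q) (≡.sym (next-prev i))))))
  where open Cyclic (suc (suc (len C)))

-- Each neighbour sits at the next or the previous position, so two of the three coincide.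
¬three-cycle-neighbours : ∀ {n} {G : Graph n} (C : Cycle G) {v a b c} →
  CycleEdge C v a → CycleEdge C v b → CycleEdge C v c → a ≢ b → a ≢ c → b ≢ c → ⊥
¬three-cycle-neighbours {G = G} C {v} {a} {b} {c} ea eb ec ab ac bc with vertex ea
  where
  vertex : CycleEdge C v a → ∃ λ i → cvert C i ≡ v
  vertex (i , inj₁ (p , _)) = i , p
  vertex (i , inj₂ (_ , p)) = next i , p
... | i , refl with cycle-neighbours C i ea | cycle-neighbours C i eb | cycle-neighbours C i ec
... | inj₁ p | inj₁ q | _      = ab (trans p (≡.sym q))
... | inj₂ p | inj₂ q | _      = ab (trans p (≡.sym q))
... | inj₁ p | inj₂ q | inj₁ r = ac (trans p (≡.sym r))
... | inj₂ p | inj₁ q | inj₂ r = ac (trans p (≡.sym r))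
... | inj₁ p | inj₂ q | inj₂ r = bc (trans q (≡.sym r))
... | inj₂ p | inj₁ q | inj₁ r = bc (trans q (≡.sym r))

-- The squared cycle, its symmetry and its non-closing path

module SquaredCycle (m : ℕ) (2≤m : 2 ≤ m) where

  open Cyclic m public

  step : Fin (suc m) → Fin (suc m) → Bool
  step x y = does (y ≟ next x) ∨ does (y ≟ next (next x))

  G : Graph (suc m)
  adj   G x y = step x y ∨ step y x
  Graph.sym G x y = Bool.∨-comm (step x y) (step y x)
  -- With at least three residues, neither one step nor two return to `x`.
  irref G x
    rewrite dec-false (x ≟ next x) (rot≢ 0 x (s≤s (≤-trans (s≤s z≤n) 2≤m)) ∘ ≡.sym)
          | dec-false (x ≟ next (next x)) (rot≢ 1 x (s≤s 2≤m) ∘ ≡.sym) = refl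

  step-elim : ∀ {x y} → step x y ≡ true → y ≡ next x ⊎ y ≡ next (next x)
  step-elim {x} {y} e with y ≟ next x | y ≟ next (next x)
  ... | yes p | _     = inj₁ p
  ... | no _  | yes p = inj₂ p
  step-elim () | no _ | no _

  adj-next : ∀ x → Adj G x (next x)
  adj-next x rewrite dec-true (next x ≟ next x) refl = refl

  adj-next² : ∀ x → Adj G x (next (next x))
  adj-next² x rewrite dec-true (next (next x) ≟ next (next x)) refl
    | Bool.∨-zeroʳ (does (next (next x) ≟ next x)) = refl

  does-next : ∀ x y → does (next x ≟ next y) ≡ does (x ≟ y)
  does-next x y with x ≟ y
  ... | yes p = dec-true (next x ≟ next y) (cong next p)
  ... | no ¬p = dec-false (next x ≟ next y) (¬p ∘ next-injective)

  step-next : ∀ x y → step (next x) (next y) ≡ step x y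
  step-next x y = cong₂ _∨_ (does-next y (next x)) (does-next y (next (next x)))

  adj-rot : ∀ k x y → adj G (rot k x) (rot k y) ≡ adj G x y
  adj-rot zero    x y = refl
  adj-rot (suc k) x y = trans
    (cong₂ _∨_ (step-next (rot k x) (rot k y)) (step-next (rot k y) (rot k x))) (adj-rot k x y)

  transitive : VertexTransitive G
  transitive u v = let k , e = rot-transitive u v in rot k , (rot-bijective k , adj-rot k) , e

  private
    ascending : ∀ a d → a + d < suc m → Σ (Path G d) λ P → vert P Fin.zero ≡ at a × vert P (fromℕ d) ≡ at (a + d)
    -- The bound on `a + d` rules out wrapping around, which makes the labels distinct.
    ascending a d p = record
      { vert = λ i → at (a + toℕ i)
      ; distinct = λ {i} {j} e → toℕ-injective (+-cancelˡ-≡ a _ _ (at-injective (bound i) (bound j) e))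
      ; edges = λ j → subst₂ (Adj G) (cong (λ z → at (a + z)) (≡.sym (toℕ-inject₁ j)))
                  (cong at (≡.sym (+-suc a (toℕ j)))) (adj-next (at (a + toℕ j)))
      } , cong at (+-identityʳ a) , cong (λ z → at (a + z)) (toℕ-fromℕ d)
      where
      bound : ∀ (i : Fin (suc d)) → a + toℕ i < suc m
      bound i = ≤-<-trans (+-monoʳ-≤ a (s≤s⁻¹ (toℕ<n i))) p

    descending : ∀ a d → a + d < suc m → Σ (Path G d) λ P → vert P Fin.zero ≡ at (a + d) × vert P (fromℕ d) ≡ at a
    descending a d p = record
      { vert = λ i → at (a + (d ∸ toℕ i))
      ; distinct = λ {i} {j} e → toℕ-injective (∸-cancelˡ-≡ (s≤s⁻¹ (toℕ<n i)) (s≤s⁻¹ (toℕ<n j))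
                     (+-cancelˡ-≡ a _ _ (at-injective (bound i) (bound j) e)))
      ; edges = λ j → Adj-sym G (at (a + (d ∸ suc (toℕ j)))) _ (subst (Adj G (at (a + (d ∸ suc (toℕ j)))))
                  (cong at (trans (≡.sym (+-suc a _)) (cong (a +_)
                     (trans (≡.sym (+-∸-assoc 1 (toℕ<n j))) (cong (d ∸_) (≡.sym (toℕ-inject₁ j)))))))
                  (adj-next (at (a + (d ∸ suc (toℕ j))))))
      } , refl , cong at (trans (cong (λ z → a + (d ∸ z)) (toℕ-fromℕ d)) (trans (cong (a +_) (n∸n≡0 d)) (+-identityʳ a)))
      where
      bound : ∀ (i : Fin (suc d)) → a + (d ∸ toℕ i) < suc m
      bound i = ≤-<-trans (+-monoʳ-≤ a (m∸n≤m d (toℕ i))) p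

  connected : Connected G
  connected u v with ≤-total (toℕ u) (toℕ v)
  ... | inj₁ u≤v = _ , let P , p , q = ascending (toℕ u) (toℕ v ∸ toℕ u) (subst (_< suc m) (≡.sym e) (toℕ<n v))
                       in P , trans p (at-toℕ u) , trans q (trans (cong at e) (at-toℕ v))
    where e = m+[n∸m]≡n u≤v
  ... | inj₂ v≤u = _ , let P , p , q = descending (toℕ v) (toℕ u ∸ toℕ v) (subst (_< suc m) (≡.sym e) (toℕ<n u))
                       in P , trans p (trans (cong at e) (at-toℕ u)) , trans q (at-toℕ v)
    where e = m+[n∸m]≡n v≤u

  -- The order 2, 0, 1, 3, 4, 5, ... uses a jump of two at its first and third edges and unit steps
  -- elsewhere. All four neighbours of 2 come after it.
  label : ℕ → ℕ
  label 0 = 2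
  label 1 = 0
  label 2 = 1
  label k@(suc (suc (suc _))) = k

  label-injective : ∀ {j k} → label j ≡ label k → j ≡ k
  label-injective {j} {k} e = trans (≡.sym (back j)) (trans (cong unlabel e) (back k))
    where
    unlabel : ℕ → ℕ
    unlabel 0 = 1
    unlabel 1 = 2
    unlabel 2 = 0
    unlabel k@(suc (suc (suc _))) = k
    back : ∀ j → unlabel (label j) ≡ j
    back 0 = refl
    back 1 = refl
    back 2 = refl
    back (suc (suc (suc _))) = refl

  label≤ : ∀ {ℓ} k → 2 ≤ ℓ → k ≤ ℓ → label k ≤ ℓ
  label≤ 0 p _ = p
  label≤ 1 p _ = z≤n
  label≤ 2 p _ = ≤-trans (s≤s z≤n) p
  label≤ (suc (suc (suc _))) _ q = q

  label-edge : ∀ k → Adj G (at (label k)) (at (label (suc k)))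
  label-edge 0 = Adj-sym G (at 0) (at 2) (adj-next² (at 0))
  label-edge 1 = adj-next (at 0)
  label-edge 2 = adj-next² (at 1)
  label-edge (suc (suc (suc k))) = adj-next _

  module _ (ℓ : ℕ) (2≤ℓ : 2 ≤ ℓ) (ℓ≤m : ℓ ≤ m) where

    private
      bound : ∀ (i : Fin (suc ℓ)) → label (toℕ i) < suc m
      bound i = s≤s (≤-trans (label≤ (toℕ i) 2≤ℓ (s≤s⁻¹ (toℕ<n i))) ℓ≤m)

    trapped : Path G ℓ
    trapped = record
      { vert = λ i → at (label (toℕ i))
      ; distinct = λ {i} {j} e → toℕ-injective (label-injective (at-injective (bound i) (bound j) e))
      ; edges = λ j → subst (λ z → Adj G (at (label z)) (at (label (suc (toℕ j))))) (≡.sym (toℕ-inject₁ j)) (label-edge (toℕ j))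
      }

  -- Steps out of 2 reach 3 and 4; steps into 2 come from 1 and 0 because `next` is injective.
  neighbours-of-2 : ∀ {y} → Adj G (at 2) y → y ≡ at 0 ⊎ y ≡ at 1 ⊎ y ≡ at 3 ⊎ y ≡ at 4
  neighbours-of-2 {y} e with step (at 2) y in p | step y (at 2) in q
  ... | true | _ with step-elim {at 2} {y} p
  ...   | inj₁ r = inj₂ (inj₂ (inj₁ r))
  ...   | inj₂ r = inj₂ (inj₂ (inj₂ r))
  neighbours-of-2 {y} e | false | true with step-elim {y} {at 2} q
  ...   | inj₁ r = inj₂ (inj₁ (≡.sym (next-injective r)))
  ...   | inj₂ r = inj₁ (≡.sym (next-injective (next-injective r)))

  -- On a cycle through the path, both cycle neighbours of 2 would have to be 0, but they are
  -- distinct.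
  trapped-not-closing : ∀ ℓ (2≤ℓ : 2 ≤ ℓ) (ℓ≤m : ℓ ≤ m) → 5 ≤ ℓ → ¬ ClosesToCycle (trapped ℓ 2≤ℓ ℓ≤m)
  trapped-not-closing ℓ 2≤ℓ ℓ≤m 5≤ℓ (C , onC , edgesC) = contra (onC Fin.zero)
    where
    -- The first five path edges; the last of them, from 4 to 5, is where `5 ≤ ℓ` is needed.
    E : ∀ k {_ : True (k <? 5)} → CycleEdge C (at (label k)) (at (label (suc k)))
    E k {p} = subst₂ (CycleEdge C) (cong (at ∘ label) (trans (toℕ-inject₁ j) e)) (cong (at ∘ label ∘ suc) e) (edgesC j)
      where
      j = fromℕ< (≤-trans (toWitness p) 5≤ℓ)
      e : toℕ j ≡ k
      e = toℕ-fromℕ< _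

    at≢ : ∀ j k {_ : True (j ≤? 5)} {_ : True (k ≤? 5)} → j ≢ k → at j ≢ at k
    at≢ j k {p} {q} ne e = ne (at-injective (below (toWitness p)) (below (toWitness q)) e)
      where
      below : ∀ {i} → i ≤ 5 → i < suc m
      below p = s≤s (≤-trans p (≤-trans 5≤ℓ ℓ≤m))

    -- The vertices 1, 3, 4 already have two neighbours along the path.
    only-0 : ∀ y → Adj G (at 2) y → CycleEdge C y (at 2) → y ≡ at 0
    only-0 y a c with neighbours-of-2 a
    ... | inj₁ e = e
    ... | inj₂ (inj₁ refl) with () ← ¬three-cycle-neighbours C c (CycleEdge-sym C (E 1)) (E 2)
            (at≢ 2 0 λ ()) (at≢ 2 3 λ ()) (at≢ 0 3 λ ())
    ... | inj₂ (inj₂ (inj₁ refl)) with () ← ¬three-cycle-neighbours C c (CycleEdge-sym C (E 2)) (E 3)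
            (at≢ 2 1 λ ()) (at≢ 2 4 λ ()) (at≢ 1 4 λ ())
    ... | inj₂ (inj₂ (inj₂ refl)) with () ← ¬three-cycle-neighbours C c (CycleEdge-sym C (E 3)) (E 4)
            (at≢ 2 3 λ ()) (at≢ 2 5 λ ()) (at≢ 3 5 λ ())

    contra : (∃ λ i → cvert C i ≡ at 2) → ⊥
    contra (i , e) = cycle-next≢prev C i (trans
      (only-0 _ (subst (λ z → Adj G z (cvert C (next i))) e (cedges C i)) (i , inj₂ (e , refl)))
      (≡.sym (only-0 _ (Adj-sym G (cvert C p) (at 2) (subst (Adj G (cvert C p)) e′ (cedges C p))) (p , inj₁ (refl , e′)))))
      where
      p = Cyclic.prev _ i
      e′ : cvert C (next p) ≡ at 2
      e′ = trans (cong (cvert C) (Cyclic.next-prev _ i)) e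

-- Infinitely many graphs are obtained as graphs of order beyond every `N`. Order `suc (N + ℓ)` is
-- also large enough for the labels up to `ℓ` to be distinct residues.
non-closing : (ℓ : ℕ) → 5 ≤ ℓ → (N : ℕ) → Σ ℕ λ n → N ≤ n × Σ (Graph n) λ G →
  Connected G × VertexTransitive G × Σ (Path G ℓ) λ P → ¬ ClosesToCycle P
non-closing ℓ 5≤ℓ N = suc (N + ℓ) , m≤n⇒m≤1+n (m≤m+n N ℓ) , G , connected , transitive ,
  trapped ℓ 2≤ℓ (m≤n+m ℓ N) , trapped-not-closing ℓ 2≤ℓ (m≤n+m ℓ N) 5≤ℓ
  where
  2≤ℓ : 2 ≤ ℓ
  2≤ℓ = ≤-trans (s≤s (s≤s z≤n)) 5≤ℓ
  open SquaredCycle (N + ℓ) (≤-trans 2≤ℓ (m≤n+m ℓ N))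

theorem1p6 : ((n : ℕ) → 3 ≤ n → (G : Graph n) → Connected G → VertexTransitive G →
    (ℓ : ℕ) → ℓ ≤ 4 → (P : Path G ℓ) → ClosesToCycle P)
    × ((ℓ : ℕ) → 5 ≤ ℓ → (N : ℕ) → Σ ℕ λ n → N ≤ n × Σ (Graph n) λ G →
    Connected G × VertexTransitive G × Σ (Path G ℓ) λ P → ¬ ClosesToCycle P)
theorem1p6 = (λ n 3≤n G conn vt → Closing.closes 3≤n G conn vt) , non-closing
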